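{- Let $(\mathcal M_*,\mathcal M_{\le\omega})$ be a Büchi abstraction (with maps $\alpha_*,\gamma_*,\alpha_{\le\omega},\gamma_{\le\omega}$) that is faithful with respect to a language $\mathfrak A\subseteq\Sigma^{\le\omega}$, i.e. $\gamma_{\le\omega}(\alpha_{\le\omega}(\mathfrak A))=\mathfrak A$. Let $P$ be a Featherweight Java program that is well-typed with respect to some standard FJ class table $(F_0,M_0)$. Then the type inference algorithm $\mathcal A(P)$ described in the context yields a Büchi class table $(F,M_{\mathfrak A})$ with respect to which $P$ is well-typed.
   Context: WORDS. $\Sigma$ is a finite alphabet, $\Sigma^*$ the finite words ($\varepsilon$ the empty word), $\Sigma^{\le\omega}$ the finite and infinite words; $U\cdot V=\{uv\mid u\in U,v\in V\}$ for $U\subseteq\Sigma^*$ and $V\subseteq\Sigma^*$ or $V\subseteq\Sigma^{\le\omega}$; $U^\omega=\{u_1u_2\cdots\mid u_i\in U\}\subseteq\Sigma^{\le\omega}$. $\mathcal P$ is powerset. SYNTAX. Sets of names: variables $\mathit{Var}\ni\mathtt{this}$, classes $\mathit{Cls}\ni\mathtt{Object},\mathtt{NullType}$, fields $\mathit{Fld}$, methods $\mathit{Mtd}$, labels $\mathit{Pos}$ (a program has finitely many classes, fields, methods and labels). Expressions: $e::=x\mid\mathtt{let}\ x=e_1\ \mathtt{in}\ e_2\mid\mathtt{if}\ x=y\ \mathtt{then}\ e_1\ \mathtt{else}\ e_2\mid\mathtt{null}\mid\mathtt{new}^{\ell}\,C\mid(C)\,e\mid\mathtt{emit}(a)\mid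 x^C.m(\bar y)\mid x^C.f\mid x^C.f:=y$ with $a\in\Sigma$, $\ell\in\mathit{Pos}$; $\mathtt{NullType}$ may not occur in $\mathtt{new}$ or casts. The annotation $C$ in $x^C$ is the static class of $x$. PROGRAMS. A program $(\prec,\mathit{fields},\mathit{methods},\mathit{mtable})$ has a finite immediate-subclass relation $\prec$ on $\mathit{Cls}$, maps $\mathit{fields},\mathit{methods}$ from classes to finite sets of fields, resp. methods (including inherited ones), and a partial map $\mathit{mtable}$ from $\mathit{Cls}\times\mathit{Mtd}$ to pairs $(\bar x,e)$ (formal parameters and body). $\preceq$ is the reflexive transitive closure of $\prec$; $C\preceq\mathtt{Object}$ and $\mathtt{NullType}\preceq C$ for all $C$. Programs are well-formed: apart from $\mathtt{NullType}$ the classes form a tree with root $\mathtt{Object}$; for $C\preceq D$ with $C\neq\mathtt{NullType}$, $\mathit{fields}(D)\subseteq\mathit{fields}(C)$ and $\mathit{methods}(D)\subseteq\mathit{methods}(C)$; $\mathtt{NullType}$ has no fields or methods; $\mathit{mtable}(C,m)$ is defined iff $m\in\mathit{methods}(C)$, and methods keep their number of parameters $\mathrm{ar}(m)$ in subclasses. STANDARD FJ TYPING. A standard FJ class table consists of a field typing $F_0:\mathit{Cls}\times\mathit{Fld}\rightharpoonup\mathit{Cls}$ (invariant under subclassing) and a method typing $M_0:\mathit{Cls}\times\mathit{Mtd}\rightharpoonup\mathit{Cls}^*\times\mathit{Cls}$ (contravariant in arguments and covariant in results under subclassing). $P$ is well-typed w.r.t. it if every body $\mathit{mtable}(C,m)=(\bar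 x,e)$ with $M_0(C,m)=(\bar C,D)$ has class $D$ in the environment $\mathtt{this}{:}C,\bar x{:}\bar C$ in the usual Featherweight Java typing: variables are typed by the environment, $\mathtt{null}$ and $\mathtt{emit}(a)$ have class $\mathtt{NullType}$, $\mathtt{new}^\ell C$ and $(C)e$ have class $C$, $\mathtt{let}$ and $\mathtt{if}$ as usual, $x^C.f$, $x^C.f:=y$, $x^C.m(\bar y)$ require $x$ to have class $C$ (with $f\in\mathit{fields}(C)$, $m\in\mathit{methods}(C)$) and are typed by $F_0(C,f)$, $M_0(C,m)$, with subsumption along $\preceq$. REGIONS. $\mathit{Reg}\ni r::=\mathtt{Null}\mid\mathtt{CreatedAt}(\ell)\mid\mathtt{Unknown}$, $\ell\in\mathit{Pos}$. $\mathit{Cls}(\mathtt{Null})=\emptyset$, $\mathit{Cls}(\mathtt{CreatedAt}(\ell))=\{C\mid\text{the program contains }\mathtt{new}^\ell C\}$, $\mathit{Cls}(\mathtt{Unknown})=\mathit{Cls}$. $\mathtt{Null}$ and all $\mathtt{CreatedAt}(\ell)$ are pairwise disjoint; $\mathtt{Unknown}$ is disjoint from no region. BÜCHI ABSTRACTION. A Büchi algebra is a pair of join-semilattices $(\mathcal M_*,\mathcal M_{\le\omega})$ (order $\sqsubseteq$, join $\sqcup$) with monotone operations $\cdot:\mathcal M_*\times\mathcal M_*\to\mathcal M_*$, $\cdot:\mathcal M_*\times\mathcal M_{\le\omega}\to\mathcal M_{\le\omega}$, $(-)^\omega:\mathcal M_*\to\mathcal M_{\le\omega}$, with $\mathcal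 A\cdot(\mathcal B\cdot\mathcal U)=(\mathcal A\cdot\mathcal B)\cdot\mathcal U$ for $\mathcal A,\mathcal B\in\mathcal M_*$, $\mathcal U\in\mathcal M_*\cup\mathcal M_{\le\omega}$. A Galois insertion between partial orders $A$ and $C$ consists of monotone $\alpha:C\to A$, $\gamma:A\to C$ with $\alpha(\gamma(a))=a$ and $\gamma(\alpha(c))\sqsupseteq c$. A Büchi abstraction is a finite Büchi algebra with Galois insertions $(\alpha_*,\gamma_*)$ between $\mathcal M_*$ and $\mathcal P(\Sigma^*)$ and $(\alpha_{\le\omega},\gamma_{\le\omega})$ between $\mathcal M_{\le\omega}$ and $\mathcal P(\Sigma^{\le\omega})$ such that $\alpha_*(A\cdot B)=\alpha_*(A)\cdot\alpha_*(B)$, $\alpha_{\le\omega}(A\cdot V)=\alpha_*(A)\cdot\alpha_{\le\omega}(V)$, $\alpha_{\le\omega}(A^\omega)=\alpha_*(A)^\omega$ for all $A,B\subseteq\Sigma^*$, $V\subseteq\Sigma^{\le\omega}$. Its least elements are $\alpha_*(\emptyset)$ and $\alpha_{\le\omega}(\emptyset)$. EXPRESSIONS AND BÜCHI CLASS TABLES. For a set $K$, $\mathcal M_*\langle K\rangle$ is the set of finite partial functions from $K$ to $\mathcal M_*$; undefined entries are treated as the least element, $\emptyset$ is the empty function, and order, join and left multiplication $\mathcal U\cdot(-)$ are pointwise. $r_1\mathrel{\&}\mathcal U_1\mid\dots\mid r_n\mathrel{\&}\mathcal U_n$ denotes the element of $\mathcal M_*\langle\mathit{Reg}\rangle$ mapping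 $r_i\mapsto\mathcal U_i$. A method signature is a tuple $(C,r,m,\bar s)$ with $m\in\mathit{methods}(C)$, $r\in\mathit{Reg}$, $\bar s\in\mathit{Reg}^{\mathrm{ar}(m)}$; $\mathit{Sig}$ is the set of these. Elements $\bigsqcup_i\mathcal A_i\cdot\delta_i$ of $\mathcal M_*\langle\mathit{Sig}\rangle$ are call expressions; $\delta$ alone denotes $\alpha_*(\{\varepsilon\})\cdot\delta$. A Büchi class table $(F,M_{\mathfrak A})$ consists of $F:\mathit{Cls}\times\mathit{Reg}\times\mathit{Fld}\rightharpoonup\mathcal P(\mathit{Reg})$ (defined for $f\in\mathit{fields}(C)$) and $M_{\mathfrak A}:\mathit{Sig}\to\mathcal M_*\langle\mathit{Reg}\rangle\times\mathcal M_*\langle\mathit{Sig}\rangle$, well-formed (wherever the entries are defined): $\mathtt{Null}\in F(C,r,f)\subseteq F(C,\mathtt{Unknown},f)$; $F(C,r,f)=F(D,r,f)$ if $C\preceq D$, $f\in\mathit{fields}(D)$; $M_{\mathfrak A}(C,r,m,\bar s)\sqsubseteq M_{\mathfrak A}(D,r,m,\bar s)$ componentwise if $C\preceq D$, $m\in\mathit{methods}(D)$. BÜCHI TYPING RULES. $\Gamma:\mathit{Var}\rightharpoonup\mathit{Reg}$; judgments $\Gamma\vdash_{\mathfrak A}e:\mathcal T\ \mathsf{calls}\ \mathcal S$ are derived by (writing $\epsilon=\alpha_*(\{\varepsilon\})$): - (sub) from $\Gamma\vdash_{\mathfrak A}e:\mathcal T\ \mathsf{calls}\ \mathcal S$, $\mathcal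 T\sqsubseteq\mathcal T'$, $\mathcal S\sqsubseteq\mathcal S'$ infer $\Gamma\vdash_{\mathfrak A}e:\mathcal T'\ \mathsf{calls}\ \mathcal S'$. - (weak) from $\Gamma\vdash_{\mathfrak A}e:(r\mathrel{\&}\mathcal U)\sqcup\mathcal T\ \mathsf{calls}\ \mathcal S$ infer $\Gamma\vdash_{\mathfrak A}e:(\mathtt{Unknown}\mathrel{\&}\mathcal U)\sqcup\mathcal T\ \mathsf{calls}\ \mathcal S$. - (prim) $\Gamma\vdash_{\mathfrak A}\mathtt{emit}(a):\mathtt{Null}\mathrel{\&}\alpha_*(\{a\})\ \mathsf{calls}\ \emptyset$. (null) $\Gamma\vdash_{\mathfrak A}\mathtt{null}:\mathtt{Null}\mathrel{\&}\epsilon\ \mathsf{calls}\ \emptyset$. (new) $\Gamma\vdash_{\mathfrak A}\mathtt{new}^\ell C:\mathtt{CreatedAt}(\ell)\mathrel{\&}\epsilon\ \mathsf{calls}\ \emptyset$. (var) $\Gamma\vdash_{\mathfrak A}x:\Gamma(x)\mathrel{\&}\epsilon\ \mathsf{calls}\ \emptyset$. - (if) from $\Gamma\vdash_{\mathfrak A}e_i:\mathcal T_i\ \mathsf{calls}\ \mathcal S_i$ ($i=1,2$), $x,y\in\mathrm{dom}(\Gamma)$, infer $\Gamma\vdash_{\mathfrak A}\mathtt{if}\ x=y\ \mathtt{then}\ e_1\ \mathtt{else}\ e_2:\mathcal T_1\sqcup\mathcal T_2\ \mathsf{calls}\ \mathcal S_1\sqcup\mathcal S_2$. - (else) if $\Gamma(x),\Gamma(y)$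 are disjoint, from $\Gamma\vdash_{\mathfrak A}e_2:\mathcal T_2\ \mathsf{calls}\ \mathcal S_2$ infer $\Gamma\vdash_{\mathfrak A}\mathtt{if}\ x=y\ \mathtt{then}\ e_1\ \mathtt{else}\ e_2:\mathcal T_2\ \mathsf{calls}\ \mathcal S_2$. - (let) from $\Gamma\vdash_{\mathfrak A}e_1:r_1\mathrel{\&}\mathcal U_1\mid\dots\mid r_n\mathrel{\&}\mathcal U_n\ \mathsf{calls}\ \mathcal S$ and $\Gamma,x{:}r_i\vdash_{\mathfrak A}e_2:\mathcal T_i\ \mathsf{calls}\ \mathcal S_i$ for all $i$ infer $\Gamma\vdash_{\mathfrak A}\mathtt{let}\ x=e_1\ \mathtt{in}\ e_2:\bigsqcup_i\mathcal U_i\cdot\mathcal T_i\ \mathsf{calls}\ \mathcal S\sqcup\bigsqcup_i\mathcal U_i\cdot\mathcal S_i$. - (cast) from $\Gamma\vdash_{\mathfrak A}e:\mathcal T\ \mathsf{calls}\ \mathcal S$ infer $\Gamma\vdash_{\mathfrak A}(D)e:\mathcal T\ \mathsf{calls}\ \mathcal S$. - (get) $\Gamma\vdash_{\mathfrak A}x^C.f:\bigsqcup\{s\mathrel{\&}\epsilon\mid s\in F(C,\Gamma(x),f)\}\ \mathsf{calls}\ \emptyset$. - (set) if $\Gamma(y)\in F(C,\Gamma(x),f)$, then $\Gamma\vdash_{\mathfrak A}x^C.f:=y:\Gamma(y)\mathrel{\&}\epsilon\ \mathsf{calls}\ \emptyset$. - (call) if $r=\Gamma(x)$, $\bar s=\Gamma(\bar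 y)$, $(\mathcal T,\_)=M_{\mathfrak A}(C,r,m,\bar s)$, then $\Gamma\vdash_{\mathfrak A}x^C.m(\bar y):\mathcal T\ \mathsf{calls}\ (C,r,m,\bar s)$. $P$ is well-typed w.r.t. $(F,M_{\mathfrak A})$ if for each $(C,r,m,\bar s)\in\mathit{Sig}$ with $C\in\mathit{Cls}(r)$, $M_{\mathfrak A}(C,r,m,\bar s)=(\mathcal T,\mathcal S)$, $\mathit{mtable}(C,m)=(\bar x,e)$, the judgment $\mathtt{this}{:}r,\bar x{:}\bar s\vdash_{\mathfrak A}e:\mathcal T\ \mathsf{calls}\ \mathcal S$ is derivable. ALGORITHM $\mathcal A(P)$. Initialize $F(C,r,f):=\{\mathtt{Null}\}$ for all $C\in\mathit{Cls}$, $r\in\mathit{Reg}$, $f\in\mathit{fields}(C)$, and $M_{\mathfrak A}(C,r,m,\bar s):=(\emptyset,\emptyset)$ for all $(C,r,m,\bar s)\in\mathit{Sig}$. Repeat the following round until a full round leaves $(F,M_{\mathfrak A})$ unchanged, then return $(F,M_{\mathfrak A})$: for each $(C,r,m,\bar s)\in\mathit{Sig}$ with $C\in\mathit{Cls}(r)$ and $(C,m)\in\mathrm{dom}(\mathit{mtable})$, let $(\bar x,e)=\mathit{mtable}(C,m)$, $\Gamma=[\mathtt{this}\mapsto r]\cup[x_i\mapsto s_i]_i$, compute $(\mathcal T,\mathcal S):=\mathrm{typeff}(\Gamma,e)$, set $M_{\mathfrak A}(C,r,m,\bar s):=M_{\mathfrak A}(C,r,m,\bar s)\sqcup(\mathcal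 T,\mathcal S)$ (componentwise), and set $(F,M_{\mathfrak A}):=\mathrm{checkClassTable}(F,M_{\mathfrak A})$, which enlarges the entries, by joining offending ones, to the least well-formed table above $(F,M_{\mathfrak A})$ (e.g. if $C\preceq D$ and $F(C,r,f)\neq F(D,r,f)$, both are set to $F(C,r,f)\cup F(D,r,f)$). $\mathrm{typeff}(\Gamma,e)$, which reads the current $(F,M_{\mathfrak A})$ and may enlarge $F$, returns: - $\mathtt{emit}(a)$: $(\mathtt{Null}\mathrel{\&}\alpha_*(\{a\}),\emptyset)$; $x$: $(\Gamma(x)\mathrel{\&}\epsilon,\emptyset)$; $\mathtt{null}$: $(\mathtt{Null}\mathrel{\&}\epsilon,\emptyset)$; $\mathtt{new}^\ell C$: $(\mathtt{CreatedAt}(\ell)\mathrel{\&}\epsilon,\emptyset)$; $(D)e$: $\mathrm{typeff}(\Gamma,e)$. - $\mathtt{if}\ x=y\ \mathtt{then}\ e_1\ \mathtt{else}\ e_2$: $\mathrm{typeff}(\Gamma,e_2)$ if $\Gamma(x),\Gamma(y)$ are disjoint, else $\mathrm{typeff}(\Gamma,e_1)\sqcup\mathrm{typeff}(\Gamma,e_2)$. - $\mathtt{let}\ x=e_1\ \mathtt{in}\ e_2$: with $(r_1\mathrel{\&}\mathcal U_1\mid\dots\mid r_n\mathrel{\&}\mathcal U_n,\mathcal S)=\mathrm{typeff}(\Gamma,e_1)$ and $(\mathcal T_i,\mathcal S_i)=\mathrm{typeff}(\Gamma[x\mapsto r_i],e_2)$, returns $(\bigsqcup_i\mathcal U_i\cdot\mathcal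 T_i,\ \mathcal S\sqcup\bigsqcup_i\mathcal U_i\cdot\mathcal S_i)$. - $x^C.f$: $(\bigsqcup\{s\mathrel{\&}\epsilon\mid s\in F(C,\Gamma(x),f)\},\emptyset)$. - $x^C.f:=y$: first $F(C,\Gamma(x),f):=F(C,\Gamma(x),f)\cup\{\Gamma(y)\}$, then returns $(\Gamma(y)\mathrel{\&}\epsilon,\emptyset)$. - $x^C.m(\bar y)$: with $(\mathcal T,\_)=M_{\mathfrak A}(C,\Gamma(x),m,\Gamma(\bar y))$, returns $(\mathcal T,(C,\Gamma(x),m,\Gamma(\bar y)))$. -}

module Defs where

open import Level using (0ℓ; _⊔_) renaming (suc to lsuc)
open import Data.Bool using (Bool; T; if_then_else_; _∧_; _∨_)
open import Data.Bool.Properties using (T?)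
open import Data.Empty using (⊥; ⊥-elim-irr)
open import Data.Fin using (Fin)
open import Data.Fin.Properties using (any?) renaming (_≟_ to _≟ᶠ_)
open import Data.Fin.Subset using (Subset; Empty; _∈_) renaming (_⊆_ to _⊆ˢ_)
open import Data.Fin.Subset.Properties using (_∈?_)
open import Data.List using (List; []; _∷_; _++_; concat; applyUpTo; length; foldr; map; allFin)
open import Data.List.Membership.Propositional using (lose) renaming (_∈_ to _∈ᴸ_)
open import Data.List.Membership.Propositional.Properties using (∈-allFin; ∈-map⁺)
open import Data.List.Relation.Unary.Any using (here; there; satisfied) renaming (any? to anyᴸ?)
import Data.List.Membership.DecPropositional as DecMembership
import Data.List.Relation.Unary.Enumerates.Setoid as Enumerates
open import Data.Maybe using (Maybe; just; nothing; _>>=_) renaming (map to mapᴹ)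
open import Data.Nat using (ℕ; zero; suc; _≤_)
open import Data.Product using (Σ; ∃; ∃₂; ∃-syntax; _×_; _,_; proj₁; proj₂)
open import Data.Product.Properties using () renaming (≡-dec to ×-≡-dec)
open import Data.Sum using (_⊎_; inj₁; inj₂)
open import Data.Sum.Relation.Binary.Pointwise using (_⊎ₛ_; inj₁; inj₂)
open import Data.Unit using (⊤)
open import Data.Vec using (Vec; []; _∷_)
open import Data.Vec.Properties using () renaming (≡-dec to Vec-≡-dec)
open import Data.Vec.Relation.Binary.Pointwise.Inductive using (Pointwise)
open import Function using (_∘_)
open import Relation.Binary.Bundles using (Setoid; Poset)
open import Relation.Binary.Core using (Rel)
open import Relation.Binary.Definitions using (Decidable; DecidableEquality; _Respects_; Monotonic₁)
open import Relation.Binary.Lattice using (JoinSemilattice)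
open import Relation.Binary.Construct.Closure.ReflexiveTransitive using (Star; _◅_; _◅◅_) renaming (ε to done)
open import Relation.Binary.PropositionalEquality
  using (_≡_; _≢_; refl; trans; cong; cong₂; setoid; _→-setoid_)
open import Relation.Nullary using (¬_; Dec; yes; no; does)
open import Relation.Nullary.Decidable using (map′; ¬?; recompute; _⊎-dec_; _×-dec_; dec⇒maybe; toWitness; fromWitness; ⌊_⌋)
open import Relation.Nullary.Negation using (contradiction)
open import Relation.Unary using (Pred; ∅; ｛_｝)
open import Relation.Unary.Relation.Binary.Subset using (⊆-poset)

record Finite {c ℓ} (S : Setoid c ℓ) : Set (c ⊔ ℓ) where
  open Setoid S
  field
    _≟_      : Decidable _≈_
    elements : List Carrier
    complete : Enumerates.IsEnumeration S elements

module Words (Letter : Set) where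

  Word : Set
  Word = List Letter

  Word≤ω-setoid : Setoid 0ℓ 0ℓ
  Word≤ω-setoid = setoid Word ⊎ₛ (ℕ →-setoid Letter)

  open Setoid Word≤ω-setoid public
    using () renaming (Carrier to Word≤ω; _≈_ to _≈ʷ_; refl to ≈ʷ-refl; sym to ≈ʷ-sym; trans to ≈ʷ-trans)

  Language* : Set₁
  Language* = Pred Word 0ℓ

  -- Infinite words are functions, compared pointwise; a language has to
  -- respect this equality.
  record Language≤ω : Set₁ where
    field
      _∋_  : Pred Word≤ω 0ℓ
      resp : _∋_ Respects _≈ʷ_
  open Language≤ω public

  _⊆ʷ_ : Rel Language≤ω 0ℓ
  V ⊆ʷ W = ∀ w → V ∋ w → W ∋ w

  Language*-poset : Poset (lsuc 0ℓ) 0ℓ 0ℓ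
  Language*-poset = ⊆-poset Word 0ℓ

  Language≤ω-poset : Poset (lsuc 0ℓ) 0ℓ 0ℓ
  Language≤ω-poset = record
    { Carrier = Language≤ω
    ; _≈_ = λ V W → V ⊆ʷ W × W ⊆ʷ V
    ; _≤_ = _⊆ʷ_
    ; isPartialOrder = record
      { isPreorder = record
        { isEquivalence = record
          { refl  = (λ _ p → p) , (λ _ p → p)
          ; sym   = λ (p , q) → q , p
          ; trans = λ (p , q) (p′ , q′) → (λ w → p′ w ∘ p w) , (λ w → q w ∘ q′ w)
          }
        ; reflexive = proj₁
        ; trans = λ p q w → q w ∘ p w
        }
      ; antisym = _,_
      }
    }

  prepend : Word → (ℕ → Letter) → (ℕ → Letter)
  prepend []      s n       = s n
  prepend (a ∷ u) s zero    = a
  prepend (a ∷ u) s (suc n) = prepend u s n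

  _⁀_ : Word → Word≤ω → Word≤ω
  u ⁀ inj₁ v = inj₁ (u ++ v)
  u ⁀ inj₂ s = inj₂ (prepend u s)

  _·*_ : Language* → Language* → Language*
  (A ·* B) w = ∃₂ λ u v → A u × B v × w ≡ u ++ v

  _·≤ω_ : Language* → Language≤ω → Language≤ω
  A ·≤ω V = record
    { _∋_  = λ w → ∃₂ λ u v → A u × V ∋ v × w ≈ʷ (u ⁀ v)
    ; resp = λ w≈w′ (u , v , u∈A , v∈V , eq) →
        u , v , u∈A , v∈V , ≈ʷ-trans (≈ʷ-sym w≈w′) eq
    }

  -- The concatenation of u 0, u 1, … is finite exactly when almost all
  -- factors are empty.
  _IsConcatenationOf_ : Word≤ω → (ℕ → Word) → Set
  inj₁ v IsConcatenationOf u =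
    ∃[ n ] ∀ k → n ≤ k → concat (applyUpTo u k) ≡ v
  inj₂ s IsConcatenationOf u =
    (∀ k → concat (applyUpTo u k) ≡ applyUpTo s (length (concat (applyUpTo u k)))) ×
    (∀ n → ∃[ k ] n ≤ length (concat (applyUpTo u k)))

  applyUpTo-cong : ∀ {s s′ : ℕ → Letter} → (∀ n → s n ≡ s′ n) → ∀ n → applyUpTo s n ≡ applyUpTo s′ n
  applyUpTo-cong eq zero    = refl
  applyUpTo-cong eq (suc n) = cong₂ _∷_ (eq zero) (applyUpTo-cong (eq ∘ suc) n)

  _^ω : Language* → Language≤ω
  A ^ω = record
    { _∋_  = λ w → ∃[ u ] (∀ i → A (u i)) × w IsConcatenationOf u
    ; resp = λ w≈w′ (u , u∈A , cat) → u , u∈A , transport w≈w′ cat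
    }
    where
    transport : ∀ {w w′ u} → w ≈ʷ w′ → w IsConcatenationOf u → w′ IsConcatenationOf u
    transport (inj₁ refl) cat = cat
    transport (inj₂ s≗s′) (prefixes , unbounded) =
      (λ k → trans (prefixes k) (applyUpTo-cong s≗s′ _)) , unbounded

record GaloisInsertion {a ℓ₁ ℓ₂ c ℓ₃ ℓ₄}
    (A : Poset a ℓ₁ ℓ₂) (C : Poset c ℓ₃ ℓ₄) : Set (a ⊔ ℓ₁ ⊔ ℓ₂ ⊔ c ⊔ ℓ₄) where
  private
    module A = Poset A
    module C = Poset C
  field
    α      : C.Carrier → A.Carrier
    γ      : A.Carrier → C.Carrier
    α-mono : Monotonic₁ C._≤_ A._≤_ α
    γ-mono : Monotonic₁ A._≤_ C._≤_ γ
    α∘γ    : ∀ a → α (γ a) A.≈ a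
    γ∘α    : ∀ c → c C.≤ γ (α c)

record BüchiAlgebra : Set₁ where
  infixl 7 _·_ _·ω_
  field
    M*  : JoinSemilattice 0ℓ 0ℓ 0ℓ
    M≤ω : JoinSemilattice 0ℓ 0ℓ 0ℓ
  module M* = JoinSemilattice M*
  module M≤ω = JoinSemilattice M≤ω
  field
    _·_      : M*.Carrier → M*.Carrier → M*.Carrier
    _·ω_     : M*.Carrier → M≤ω.Carrier → M≤ω.Carrier
    _^ω      : M*.Carrier → M≤ω.Carrier
    ·-mono   : ∀ {a a′ b b′} → a M*.≤ a′ → b M*.≤ b′ → (a · b) M*.≤ (a′ · b′)
    ·ω-mono  : ∀ {a a′ u u′} → a M*.≤ a′ → u M≤ω.≤ u′ → (a ·ω u) M≤ω.≤ (a′ ·ω u′)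
    ^ω-mono  : ∀ {a a′} → a M*.≤ a′ → (a ^ω) M≤ω.≤ (a′ ^ω)
    ·-assoc  : ∀ a b c → (a · (b · c)) M*.≈ ((a · b) · c)
    ·ω-assoc : ∀ a b u → (a ·ω (b ·ω u)) M≤ω.≈ ((a · b) ·ω u)

record BüchiAbstraction (Letter : Set) : Set₁ where
  private module W = Words Letter
  field
    algebra : BüchiAlgebra
  open BüchiAlgebra algebra public
  field
    M*-finite   : Finite (Poset.Eq.setoid M*.poset)
    M≤ω-finite  : Finite (Poset.Eq.setoid M≤ω.poset)
    insertion*  : GaloisInsertion M*.poset W.Language*-poset
    insertion≤ω : GaloisInsertion M≤ω.poset W.Language≤ω-poset
  open GaloisInsertion insertion* public using ()
    renaming (α to α*; γ to γ*; α-mono to α*-mono; γ-mono to γ*-mono; α∘γ to α*∘γ*; γ∘α to γ*∘α*)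
  open GaloisInsertion insertion≤ω public using ()
    renaming (α to α≤ω; γ to γ≤ω; α-mono to α≤ω-mono; γ-mono to γ≤ω-mono;
              α∘γ to α≤ω∘γ≤ω; γ∘α to γ≤ω∘α≤ω)
  field
    α*-·   : ∀ A B → α* (A W.·* B) M*.≈ (α* A · α* B)
    α≤ω-·  : ∀ A V → α≤ω (A W.·≤ω V) M≤ω.≈ (α* A ·ω α≤ω V)
    α≤ω-^ω : ∀ A → α≤ω (A W.^ω) M≤ω.≈ ((α* A) ^ω)

Faithful : ∀ {Letter} → BüchiAbstraction Letter → Words.Language≤ω Letter → Set
Faithful {Letter} 𝔅 𝔄 = γ≤ω (α≤ω 𝔄) ≈ 𝔄
  where
  open BüchiAbstraction 𝔅
  open Poset (Words.Language≤ω-poset Letter)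

module StarDec {n : ℕ} {R : Rel (Fin n) 0ℓ} (R? : Decidable R) where

  -- Paths whose intermediate vertices are drawn from a list.
  Via : List (Fin n) → Rel (Fin n) 0ℓ
  Via []       x y = x ≡ y ⊎ R x y
  Via (v ∷ vs) x y = Via vs x y ⊎ (Via vs x v × Via vs v y)

  via? : ∀ vs → Decidable (Via vs)
  via? []       x y = (x ≟ᶠ y) ⊎-dec R? x y
  via? (v ∷ vs) x y = via? vs x y ⊎-dec (via? vs x v ×-dec via? vs v y)

  via⇒star : ∀ vs {x y} → Via vs x y → Star R x y
  via⇒star []       (inj₁ refl)    = done
  via⇒star []       (inj₂ r)       = r ◅ done
  via⇒star (v ∷ vs) (inj₁ p)       = via⇒star vs p
  via⇒star (v ∷ vs) (inj₂ (p , q)) = via⇒star vs p ◅◅ via⇒star vs q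

  via-base : ∀ vs {x y} → Via [] x y → Via vs x y
  via-base []       p = p
  via-base (v ∷ vs) p = inj₁ (via-base vs p)

  via-trans : ∀ {vs x u y} → u ∈ᴸ vs → Via vs x u → Via vs u y → Via vs x y
  via-trans {v ∷ vs} {x} {_} {y} (here refl) p q = inj₂ (to-v p , from-v q)
    where
    to-v : Via (v ∷ vs) x v → Via vs x v
    to-v (inj₁ p)       = p
    to-v (inj₂ (p , _)) = p
    from-v : Via (v ∷ vs) v y → Via vs v y
    from-v (inj₁ q)       = q
    from-v (inj₂ (_ , q)) = q
  via-trans (there u∈) (inj₁ p)       (inj₁ q)       = inj₁ (via-trans u∈ p q)
  via-trans (there u∈) (inj₁ p)       (inj₂ (q , r)) = inj₂ (via-trans u∈ p q , r)
  via-trans (there u∈) (inj₂ (p , q)) (inj₁ r)       = inj₂ (p , via-trans u∈ q r)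
  via-trans (there u∈) (inj₂ (p , q)) (inj₂ (r , s)) = inj₂ (p , s)

  star⇒via : ∀ {x y} → Star R x y → Via (allFin n) x y
  star⇒via done     = via-base (allFin n) (inj₁ refl)
  star⇒via (r ◅ rs) =
    via-trans (∈-allFin _) (via-base (allFin n) (inj₂ r)) (star⇒via rs)

  star? : Decidable (Star R)
  star? x y = map′ (via⇒star (allFin n)) star⇒via (via? (allFin n) x y)

Σ-dec-irr : ∀ {A : Set} {B : .A → Set} → Dec A → (.(a : A) → Dec (B a)) → Dec (Σ A (λ a → B a))
Σ-dec-irr (no ¬a) B? = no (¬a ∘ proj₁)
Σ-dec-irr (yes a) B? = map′ (a ,_) proj₂ (B? a)

record Names : Set₁ where
  field
    Var             : Set
    _≟ⱽ_            : DecidableEquality Var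
    this            : Var
    #Cls #Fld #Mtd #Pos : ℕ
    Object NullType : Fin #Cls
    ar              : Fin #Mtd → ℕ

  Cls Fld Mtd Pos : Set
  Cls = Fin #Cls
  Fld = Fin #Fld
  Mtd = Fin #Mtd
  Pos = Fin #Pos

module FJ (Letter : Set) (N : Names) where
  open Names N

  -- The class argument of call, get and set is the static class annotating
  -- the variable x.
  data Expr : Set where
    var    : (x : Var) → Expr
    letin  : (x : Var) (e₁ e₂ : Expr) → Expr
    ifeq   : (x y : Var) (e₁ e₂ : Expr) → Expr
    null   : Expr
    new    : (ℓ : Pos) (C : Cls) → C ≢ NullType → Expr
    cast   : (C : Cls) → C ≢ NullType → Expr → Expr
    emit   : (a : Letter) → Expr
    call   : (x : Var) (C : Cls) (m : Mtd) (ys : Vec Var (ar m)) → Expr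
    get    : (x : Var) (C : Cls) (f : Fld) → Expr
    set    : (x : Var) (C : Cls) (f : Fld) (y : Var) → Expr

  allocations : Expr → List (Pos × Cls)
  allocations (letin x e₁ e₂)  = allocations e₁ ++ allocations e₂
  allocations (ifeq x y e₁ e₂) = allocations e₁ ++ allocations e₂
  allocations (new ℓ C _)      = (ℓ , C) ∷ []
  allocations (cast C _ e)     = allocations e
  allocations _                = []

  Env : Set → Set
  Env A = Var → Maybe A

  _[_↦_] : ∀ {A} → Env A → Var → A → Env A
  (Γ [ x ↦ v ]) y = if does (y ≟ⱽ x) then just v else Γ y

  -- Parameters are not required to be distinct; a later one shadows this and
  -- the earlier ones.
  methodEnv : ∀ {A n} → A → Vec Var n → Vec A n → Env A
  methodEnv {A} c xs vs = bind xs vs ((λ _ → nothing) [ this ↦ c ])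
    where
    bind : ∀ {n} → Vec Var n → Vec A n → Env A → Env A
    bind []       []       Γ = Γ
    bind (x ∷ xs) (v ∷ vs) Γ = bind xs vs (Γ [ x ↦ v ])

  -- A partial map whose domain is prescribed is a function that takes an
  -- irrelevant proof of membership in that domain; this is how mtable, and
  -- below F₀, M₀, F and the set Sig, are encoded.
  record Program : Set₁ where
    field
      _≺_     : Rel Cls 0ℓ
      _≺?_    : Decidable _≺_
      fields  : Cls → Subset #Fld
      methods : Cls → Subset #Mtd
      mtable  : (C : Cls) (m : Mtd) → .(m ∈ methods C) → Vec Var (ar m) × Expr

    _⪯_ : Rel Cls 0ℓ
    _⪯_ = Star _≺_

    -- The classes other than NullType, which form the tree.
    _≺ᵗ_ : Rel Cls 0ℓ
    C ≺ᵗ D = C ≢ NullType × D ≢ NullType × C ≺ D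

    field
      Object≢NullType   : Object ≢ NullType
      Object-root       : ∀ {D} → ¬ (Object ≺ᵗ D)
      parent-unique     : ∀ {C D E} → C ≺ᵗ D → C ≺ᵗ E → D ≡ E
      root-reachable    : ∀ {C} → C ≢ NullType → Star _≺ᵗ_ C Object
      NullType⪯         : ∀ C → NullType ⪯ C
      fields-inherited  : ∀ {C D} → C ⪯ D → C ≢ NullType → fields D ⊆ˢ fields C
      methods-inherited : ∀ {C D} → C ⪯ D → C ≢ NullType → methods D ⊆ˢ methods C
      NullType-fields   : Empty (fields NullType)
      NullType-methods  : Empty (methods NullType)

    _⪯?_ : Decidable _⪯_
    _⪯?_ = StarDec.star? _≺?_

    Contains-new : Pos → Cls → Set
    Contains-new ℓ C = ∃₂ λ D m → Σ (m ∈ methods D) λ m∈ →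
      (ℓ , C) ∈ᴸ allocations (proj₂ (mtable D m m∈))

    contains-new? : Decidable Contains-new
    contains-new? ℓ C =
      any? λ D → any? λ m → Σ-dec-irr (m ∈? methods D) λ m∈ →
        (ℓ , C) ∈ᴸ? allocations (proj₂ (mtable D m m∈))
      where open DecMembership (×-≡-dec _≟ᶠ_ _≟ᶠ_) renaming (_∈?_ to _∈ᴸ?_)

  module Standard (P : Program) where
    open Program P

    record ClassTable : Set where
      field
        F₀ : (C : Cls) (f : Fld) → .(f ∈ fields C) → Cls
        M₀ : (C : Cls) (m : Mtd) → .(m ∈ methods C) → Vec Cls (ar m) × Cls
        F₀-invariant : ∀ {C D f} → C ⪯ D → .(p : f ∈ fields C) .(q : f ∈ fields D) →
          F₀ C f p ≡ F₀ D f q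
        M₀-contravariant : ∀ {C D m} → C ⪯ D → .(p : m ∈ methods C) .(q : m ∈ methods D) →
          Pointwise _⪯_ (proj₁ (M₀ D m q)) (proj₁ (M₀ C m p))
        M₀-covariant : ∀ {C D m} → C ⪯ D → .(p : m ∈ methods C) .(q : m ∈ methods D) →
          proj₂ (M₀ C m p) ⪯ proj₂ (M₀ D m q)

    module _ (𝒯 : ClassTable) where
      open ClassTable 𝒯

      infix 4 _⊢_∶_
      data _⊢_∶_ (Γ : Env Cls) : Expr → Cls → Set where
        sub  : ∀ {e C D} → Γ ⊢ e ∶ C → C ⪯ D → Γ ⊢ e ∶ D
        var  : ∀ {x C} → Γ x ≡ just C → Γ ⊢ var x ∶ C
        null : Γ ⊢ null ∶ NullType
        emit : ∀ {a} → Γ ⊢ emit a ∶ NullType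
        new  : ∀ {ℓ C C≢} → Γ ⊢ new ℓ C C≢ ∶ C
        cast : ∀ {C C≢ e D} → Γ ⊢ e ∶ D → Γ ⊢ cast C C≢ e ∶ C
        letin : ∀ {x e₁ e₂ C D} →
          Γ ⊢ e₁ ∶ C → (Γ [ x ↦ C ]) ⊢ e₂ ∶ D → Γ ⊢ letin x e₁ e₂ ∶ D
        ifeq : ∀ {x y e₁ e₂ C D E} →
          Γ ⊢ var x ∶ C → Γ ⊢ var y ∶ D → Γ ⊢ e₁ ∶ E → Γ ⊢ e₂ ∶ E → Γ ⊢ ifeq x y e₁ e₂ ∶ E
        get  : ∀ {x C f} (f∈ : f ∈ fields C) →
          Γ ⊢ var x ∶ C → Γ ⊢ get x C f ∶ F₀ C f f∈
        set  : ∀ {x C f y} (f∈ : f ∈ fields C) →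
          Γ ⊢ var x ∶ C → Γ ⊢ var y ∶ F₀ C f f∈ → Γ ⊢ set x C f y ∶ F₀ C f f∈
        call : ∀ {x C m ys} (m∈ : m ∈ methods C) →
          Γ ⊢ var x ∶ C → Pointwise (λ y D → Γ ⊢ var y ∶ D) ys (proj₁ (M₀ C m m∈)) →
          Γ ⊢ call x C m ys ∶ proj₂ (M₀ C m m∈)

      WellTyped : Set
      WellTyped = ∀ C m (m∈ : m ∈ methods C) →
        let (xs , e) = mtable C m m∈
            (Cs , D) = M₀ C m m∈
        in methodEnv C xs Cs ⊢ e ∶ D

  data Reg : Set where
    Null      : Reg
    CreatedAt : Pos → Reg
    Unknown   : Reg

  _≟ᴿ_ : DecidableEquality Reg
  Null        ≟ᴿ Null         = yes refl
  Null        ≟ᴿ CreatedAt _  = no λ ()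
  Null        ≟ᴿ Unknown      = no λ ()
  CreatedAt _ ≟ᴿ Null         = no λ ()
  CreatedAt ℓ ≟ᴿ CreatedAt ℓ′ = map′ (cong CreatedAt) (λ { refl → refl }) (ℓ ≟ᶠ ℓ′)
  CreatedAt _ ≟ᴿ Unknown      = no λ ()
  Unknown     ≟ᴿ Null         = no λ ()
  Unknown     ≟ᴿ CreatedAt _  = no λ ()
  Unknown     ≟ᴿ Unknown      = yes refl

  regions : List Reg
  regions = Null ∷ Unknown ∷ map CreatedAt (allFin #Pos)

  ∈-regions : ∀ r → r ∈ᴸ regions
  ∈-regions Null          = here refl
  ∈-regions Unknown       = there (here refl)
  ∈-regions (CreatedAt ℓ) = there (there (∈-map⁺ CreatedAt (∈-allFin ℓ)))

  Disjoint : Rel Reg 0ℓ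
  Disjoint r s = r ≢ Unknown × s ≢ Unknown × r ≢ s

  disjoint? : Decidable Disjoint
  disjoint? r s = ¬? (r ≟ᴿ Unknown) ×-dec (¬? (s ≟ᴿ Unknown) ×-dec ¬? (r ≟ᴿ s))

  RegSet : Set
  RegSet = Reg → Bool

  _∈ᴿ_ : Reg → RegSet → Set
  s ∈ᴿ A = T (A s)

  _⊆ᴿ_ : Rel RegSet 0ℓ
  A ⊆ᴿ B = ∀ s → s ∈ᴿ A → s ∈ᴿ B

  _≐ᴿ_ : Rel RegSet 0ℓ
  A ≐ᴿ B = A ⊆ᴿ B × B ⊆ᴿ A

  _∪ᴿ_ : RegSet → RegSet → RegSet
  (A ∪ᴿ B) s = A s ∨ B s

  ⁅_⁆ᴿ : Reg → RegSet
  ⁅ r ⁆ᴿ s = does (s ≟ᴿ r)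

  module Inference (𝔅 : BüchiAbstraction Letter) (P : Program) where
    open BüchiAbstraction 𝔅
    open Program P

    _∈Cls_ : Cls → Reg → Set
    C ∈Cls Null        = ⊥
    C ∈Cls CreatedAt ℓ = Contains-new ℓ C
    C ∈Cls Unknown     = ⊤

    _∈Cls?_ : Decidable _∈Cls_
    C ∈Cls? Null        = no λ ()
    C ∈Cls? CreatedAt ℓ = contains-new? ℓ C
    C ∈Cls? Unknown     = yes _

    record Sig : Set where
      constructor sig
      field
        cls   : Cls
        reg   : Reg
        mtd   : Mtd
        .mtd∈ : mtd ∈ methods cls
        args  : Vec Reg (ar mtd)
    open Sig public

    _≟ˢ_ : DecidableEquality Sig
    sig C r m _ ss ≟ˢ sig C′ r′ m′ _ ss′ with C ≟ᶠ C′ | r ≟ᴿ r′ | m ≟ᶠ m′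
    ... | no C≢    | _        | _        = no λ { refl → C≢ refl }
    ... | yes _    | no r≢    | _        = no λ { refl → r≢ refl }
    ... | yes _    | yes _    | no m≢    = no λ { refl → m≢ refl }
    ... | yes refl | yes refl | yes refl =
      map′ (λ { refl → refl }) (λ { refl → refl }) (Vec-≡-dec _≟ᴿ_ ss ss′)

    infix  4 _⊑_
    infixr 6 _⊔ᵐ_ _⊔ᵖ_
    infixr 7 _·ᵖ_

    M⟨_⟩ : Set → Set
    M⟨ K ⟩ = K → Maybe M*.Carrier

    -- The least element, which undefined entries stand for.
    ⊥* : M*.Carrier
    ⊥* = α* ∅

    ⟦_⟧ : Maybe M*.Carrier → M*.Carrier
    ⟦ just a  ⟧ = a
    ⟦ nothing ⟧ = ⊥*

    _⊑_ : ∀ {K} → Rel M⟨ K ⟩ 0ℓ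
    X ⊑ Y = ∀ k → ⟦ X k ⟧ M*.≤ ⟦ Y k ⟧

    _⊔ᵐ_ : Maybe M*.Carrier → Maybe M*.Carrier → Maybe M*.Carrier
    nothing ⊔ᵐ b       = b
    just a  ⊔ᵐ nothing = just a
    just a  ⊔ᵐ just b  = just (a M*.∨ b)

    _⊔ᵖ_ : ∀ {K} → M⟨ K ⟩ → M⟨ K ⟩ → M⟨ K ⟩
    (X ⊔ᵖ Y) k = X k ⊔ᵐ Y k

    ∅ᵖ : ∀ {K} → M⟨ K ⟩
    ∅ᵖ _ = nothing

    _·ᵖ_ : ∀ {K} → M*.Carrier → M⟨ K ⟩ → M⟨ K ⟩
    (a ·ᵖ X) k = mapᴹ (a ·_) (X k)

    ε* : M*.Carrier
    ε* = α* ｛ [] ｝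

    _&_ : Reg → M*.Carrier → M⟨ Reg ⟩
    (r & a) s = if does (s ≟ᴿ r) then just a else nothing

    δ : Sig → M⟨ Sig ⟩
    δ σ τ = if does (τ ≟ˢ σ) then just ε* else nothing

    -- ⨆ { s & ε | s ∈ A }
    _&ε : RegSet → M⟨ Reg ⟩
    (A &ε) s = if A s then just ε* else nothing

    -- ⨆ᵢ Uᵢ · Y rᵢ where X = r₁ & U₁ | … | rₙ & Uₙ; the values of Y outside
    -- r₁, …, rₙ are not used.
    ⨆ : ∀ {K} → M⟨ Reg ⟩ → (Reg → M⟨ K ⟩) → M⟨ K ⟩
    ⨆ {K} X Y = foldr (λ r Z → summand r (X r) ⊔ᵖ Z) ∅ᵖ regions
      where
      summand : Reg → Maybe M*.Carrier → M⟨ K ⟩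
      summand r (just U) = U ·ᵖ Y r
      summand r nothing  = ∅ᵖ

    Effect : Set
    Effect = M⟨ Reg ⟩ × M⟨ Sig ⟩

    record _⊑ᵉ_ (E E′ : Effect) : Set where
      constructor _,_
      field
        type-⊑  : proj₁ E ⊑ proj₁ E′
        calls-⊑ : proj₂ E ⊑ proj₂ E′
    open _⊑ᵉ_ public

    _⊔ᵉ_ : Effect → Effect → Effect
    (T , S) ⊔ᵉ (T′ , S′) = T ⊔ᵖ T′ , S ⊔ᵖ S′

    ∅ᵉ : Effect
    ∅ᵉ = ∅ᵖ , ∅ᵖ

    FieldTyping : Set
    FieldTyping = (C : Cls) → Reg → (f : Fld) → .(f ∈ fields C) → RegSet

    MethodTyping : Set
    MethodTyping = Sig → Effect

    Table : Set
    Table = FieldTyping × MethodTyping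

    _≼_ : Rel Table 0ℓ
    (F , M) ≼ (F′ , M′) =
      (∀ C r f .(f∈ : f ∈ fields C) → F C r f f∈ ⊆ᴿ F′ C r f f∈) ×
      (∀ σ → M σ ⊑ᵉ M′ σ)

    _≋_ : Rel Table 0ℓ
    t ≋ t′ = t ≼ t′ × t′ ≼ t

    record WellFormed (t : Table) : Set where
      private
        F = proj₁ t
        M = proj₂ t
      field
        F-Null    : ∀ C r f .(f∈ : f ∈ fields C) → Null ∈ᴿ F C r f f∈
        F-Unknown : ∀ C r f .(f∈ : f ∈ fields C) → F C r f f∈ ⊆ᴿ F C Unknown f f∈
        F-inv     : ∀ {C D} → C ⪯ D → ∀ r f .(p : f ∈ fields C) .(q : f ∈ fields D) →
          F C r f p ≐ᴿ F D r f q
        M-mono    : ∀ {C D} → C ⪯ D → ∀ r m .(p : m ∈ methods C) .(q : m ∈ methods D) ss →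
          M (sig C r m p ss) ⊑ᵉ M (sig D r m q ss)

    module _ (t : Table) where
      private
        F = proj₁ t
        M = proj₂ t

      infix 4 _⊢_∶_calls_
      data _⊢_∶_calls_ (Γ : Env Reg) : Expr → M⟨ Reg ⟩ → M⟨ Sig ⟩ → Set where
        sub  : ∀ {e T T′ S S′} →
          Γ ⊢ e ∶ T calls S → T ⊑ T′ → S ⊑ S′ → Γ ⊢ e ∶ T′ calls S′
        weak : ∀ {e r U T S} →
          Γ ⊢ e ∶ (r & U) ⊔ᵖ T calls S → Γ ⊢ e ∶ (Unknown & U) ⊔ᵖ T calls S
        prim : ∀ {a} → Γ ⊢ emit a ∶ Null & α* ｛ a ∷ [] ｝ calls ∅ᵖ
        null : Γ ⊢ null ∶ Null & ε* calls ∅ᵖ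
        new  : ∀ {ℓ C C≢} → Γ ⊢ new ℓ C C≢ ∶ CreatedAt ℓ & ε* calls ∅ᵖ
        var  : ∀ {x r} → Γ x ≡ just r → Γ ⊢ var x ∶ r & ε* calls ∅ᵖ
        if   : ∀ {x y r s e₁ e₂ T₁ T₂ S₁ S₂} → Γ x ≡ just r → Γ y ≡ just s →
          Γ ⊢ e₁ ∶ T₁ calls S₁ → Γ ⊢ e₂ ∶ T₂ calls S₂ →
          Γ ⊢ ifeq x y e₁ e₂ ∶ T₁ ⊔ᵖ T₂ calls S₁ ⊔ᵖ S₂
        else : ∀ {x y r s e₁ e₂ T₂ S₂} → Γ x ≡ just r → Γ y ≡ just s → Disjoint r s →
          Γ ⊢ e₂ ∶ T₂ calls S₂ → Γ ⊢ ifeq x y e₁ e₂ ∶ T₂ calls S₂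
        letin : ∀ {x e₁ e₂ R S} {Ts : Reg → M⟨ Reg ⟩} {Ss : Reg → M⟨ Sig ⟩} →
          Γ ⊢ e₁ ∶ R calls S →
          (∀ {r U} → R r ≡ just U → (Γ [ x ↦ r ]) ⊢ e₂ ∶ Ts r calls Ss r) →
          Γ ⊢ letin x e₁ e₂ ∶ ⨆ R Ts calls S ⊔ᵖ ⨆ R Ss
        cast : ∀ {D D≢ e T S} → Γ ⊢ e ∶ T calls S → Γ ⊢ cast D D≢ e ∶ T calls S
        get  : ∀ {x C f r} (f∈ : f ∈ fields C) → Γ x ≡ just r →
          Γ ⊢ get x C f ∶ F C r f f∈ &ε calls ∅ᵖ
        set  : ∀ {x C f y r s} (f∈ : f ∈ fields C) → Γ x ≡ just r → Γ y ≡ just s →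
          s ∈ᴿ F C r f f∈ → Γ ⊢ set x C f y ∶ s & ε* calls ∅ᵖ
        call : ∀ {x C m ys r ss} (m∈ : m ∈ methods C) → Γ x ≡ just r →
          Pointwise (λ y s → Γ y ≡ just s) ys ss →
          Γ ⊢ call x C m ys ∶ proj₁ (M (sig C r m m∈ ss)) calls δ (sig C r m m∈ ss)

      WellTyped : Set
      WellTyped = ∀ C r m .(m∈ : m ∈ methods C) ss → C ∈Cls r →
        let (xs , e) = mtable C m m∈
            (T , S)  = M (sig C r m m∈ ss)
        in methodEnv r xs ss ⊢ e ∶ T calls S

    _[_,_,_]∪_ : FieldTyping → Cls → Reg → Fld → Reg → FieldTyping
    (F [ C , r , f ]∪ s) C′ r′ f′ f∈ =
      if does (C′ ≟ᶠ C) ∧ does (r′ ≟ᴿ r) ∧ does (f′ ≟ᶠ f)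
      then F C′ r′ f′ f∈ ∪ᴿ ⁅ s ⁆ᴿ
      else F C′ r′ f′ f∈

    _[_]⊔_ : MethodTyping → Sig → Effect → MethodTyping
    (M [ σ ]⊔ E) τ = if does (τ ≟ˢ σ) then M τ ⊔ᵉ E else M τ

    lookupAll : ∀ {A n} → Env A → Vec Var n → Maybe (Vec A n)
    lookupAll Γ []       = just []
    lookupAll Γ (y ∷ ys) = do
      v  ← Γ y
      vs ← lookupAll Γ ys
      just (v ∷ vs)

    -- Evaluates the body for r₁, …, rₙ in turn, where X = r₁ & U₁ | … | rₙ & Uₙ,
    -- and collects (⨆ᵢ Uᵢ · Tᵢ , ⨆ᵢ Uᵢ · Sᵢ).
    branches : M⟨ Reg ⟩ → (Reg → FieldTyping → Maybe (Effect × FieldTyping)) →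
      List Reg → FieldTyping → Maybe (Effect × FieldTyping)
    branches X body []       F = just (∅ᵉ , F)
    branches X body (r ∷ rs) F with X r
    ... | nothing = branches X body rs F
    ... | just U  = do
      ((T , S) , F₁) ← body r F
      (E , F₂)       ← branches X body rs F₁
      just ((U ·ᵖ T , U ·ᵖ S) ⊔ᵉ E , F₂)

    -- The result is nothing if an unbound variable, or a field or method that
    -- the annotated class does not have, is encountered.
    typeff : MethodTyping → Env Reg → Expr → FieldTyping → Maybe (Effect × FieldTyping)
    typeff M Γ (emit a) F    = just ((Null & α* ｛ a ∷ [] ｝ , ∅ᵖ) , F)
    typeff M Γ (var x) F     = do
      r ← Γ x
      just ((r & ε* , ∅ᵖ) , F)
    typeff M Γ null F        = just ((Null & ε* , ∅ᵖ) , F)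
    typeff M Γ (new ℓ C _) F = just ((CreatedAt ℓ & ε* , ∅ᵖ) , F)
    typeff M Γ (cast D _ e) F = typeff M Γ e F
    typeff M Γ (ifeq x y e₁ e₂) F = do
      r ← Γ x
      s ← Γ y
      if does (disjoint? r s)
        then typeff M Γ e₂ F
        else (do
          (E₁ , F₁) ← typeff M Γ e₁ F
          (E₂ , F₂) ← typeff M Γ e₂ F₁
          just (E₁ ⊔ᵉ E₂ , F₂))
    typeff M Γ (letin x e₁ e₂) F = do
      ((R , S) , F₁) ← typeff M Γ e₁ F
      ((T′ , S′) , F₂) ← branches R (λ r → typeff M (Γ [ x ↦ r ]) e₂) regions F₁
      just ((T′ , S ⊔ᵖ S′) , F₂)
    typeff M Γ (get x C f) F = do
      r  ← Γ x
      f∈ ← dec⇒maybe (f ∈? fields C)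
      just ((F C r f f∈ &ε , ∅ᵖ) , F)
    typeff M Γ (set x C f y) F = do
      r  ← Γ x
      s  ← Γ y
      f∈ ← dec⇒maybe (f ∈? fields C)
      just ((s & ε* , ∅ᵖ) , F [ C , r , f ]∪ s)
    typeff M Γ (call x C m ys) F = do
      r  ← Γ x
      ss ← lookupAll Γ ys
      m∈ ← dec⇒maybe (m ∈? methods C)
      let σ = sig C r m m∈ ss
      just ((proj₁ (M σ) , δ σ) , F)

    ⊥*-least : ∀ a → ⊥* M*.≤ a
    ⊥*-least a = M*.trans (α*-mono (λ ())) (M*.reflexive (α*∘γ* a))

    ⊔ᵐ-upperˡ : ∀ a b → ⟦ a ⟧ M*.≤ ⟦ a ⊔ᵐ b ⟧
    ⊔ᵐ-upperˡ nothing  b        = ⊥*-least _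
    ⊔ᵐ-upperˡ (just a) nothing  = M*.refl
    ⊔ᵐ-upperˡ (just a) (just b) = M*.x≤x∨y a b

    ⊔ᵐ-upperʳ : ∀ a b → ⟦ b ⟧ M*.≤ ⟦ a ⊔ᵐ b ⟧
    ⊔ᵐ-upperʳ nothing  b        = M*.refl
    ⊔ᵐ-upperʳ (just a) nothing  = ⊥*-least a
    ⊔ᵐ-upperʳ (just a) (just b) = M*.y≤x∨y a b

    ⊔ᵐ-least : ∀ a b {c} → ⟦ a ⟧ M*.≤ c → ⟦ b ⟧ M*.≤ c → ⟦ a ⊔ᵐ b ⟧ M*.≤ c
    ⊔ᵐ-least nothing  b        p q = q
    ⊔ᵐ-least (just a) nothing  p q = p
    ⊔ᵐ-least (just a) (just b) p q = M*.∨-least p q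

    ⊑ᵉ-refl : ∀ {E} → E ⊑ᵉ E
    ⊑ᵉ-refl = (λ _ → M*.refl) , (λ _ → M*.refl)

    ⊑ᵉ-trans : ∀ {D E G} → D ⊑ᵉ E → E ⊑ᵉ G → D ⊑ᵉ G
    ⊑ᵉ-trans (p , q) (p′ , q′) = (λ k → M*.trans (p k) (p′ k)) , (λ k → M*.trans (q k) (q′ k))

    ∅ᵉ-least : ∀ {E} → ∅ᵉ ⊑ᵉ E
    ∅ᵉ-least = (λ _ → ⊥*-least _) , (λ _ → ⊥*-least _)

    ⨆ᵉ : (Cls → Effect) → List Cls → Effect
    ⨆ᵉ E = foldr (λ C → E C ⊔ᵉ_) ∅ᵉ

    ⨆ᵉ-upper : ∀ E {C Cs} → C ∈ᴸ Cs → E C ⊑ᵉ ⨆ᵉ E Cs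
    ⨆ᵉ-upper E (here refl) = (λ _ → ⊔ᵐ-upperˡ (proj₁ (E _) _) _) , (λ _ → ⊔ᵐ-upperˡ (proj₂ (E _) _) _)
    ⨆ᵉ-upper E (there C∈)  = ⊑ᵉ-trans (⨆ᵉ-upper E C∈)
      ((λ _ → ⊔ᵐ-upperʳ (proj₁ (E _) _) _) , (λ _ → ⊔ᵐ-upperʳ (proj₂ (E _) _) _))

    ⨆ᵉ-least : ∀ E {X} Cs → (∀ C → E C ⊑ᵉ X) → ⨆ᵉ E Cs ⊑ᵉ X
    ⨆ᵉ-least E []       least = ∅ᵉ-least
    ⨆ᵉ-least E (C ∷ Cs) least =
      (λ k → ⊔ᵐ-least (proj₁ (E C) k) _ (type-⊑ (least C) k) (type-⊑ (⨆ᵉ-least E Cs least) k)) ,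
      (λ k → ⊔ᵐ-least (proj₂ (E C) k) _ (calls-⊑ (least C) k) (calls-⊑ (⨆ᵉ-least E Cs least) k))

    IsLeastWellFormedAbove : Table → Table → Set
    IsLeastWellFormedAbove t t′ =
      WellFormed t′ × t ≼ t′ × (∀ t″ → WellFormed t″ → t ≼ t″ → t′ ≼ t″)

    -- F⁺ C r f consists of Null and all F D r′ f where D is connected to C by a
    -- zigzag of subclassings among classes that have f, and r′ is r, or any
    -- region if r is Unknown; M⁺ is the join over all subclasses.
    module Closure (F : FieldTyping) (M : MethodTyping) where

      LinkStep : Fld → Rel Cls 0ℓ
      LinkStep f C D = f ∈ fields C × f ∈ fields D × (C ⪯ D ⊎ D ⪯ C)

      Linked : Fld → Rel Cls 0ℓ
      Linked f = Star (LinkStep f)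

      linked? : ∀ f → Decidable (Linked f)
      linked? f = StarDec.star? λ C D →
        (f ∈? fields C) ×-dec ((f ∈? fields D) ×-dec ((C ⪯? D) ⊎-dec (D ⪯? C)))

      Origin : Cls → Reg → Fld → Reg → Cls → Reg → Set
      Origin C r f s D r′ =
        (r′ ≡ r ⊎ r ≡ Unknown) × Linked f C D × Σ (f ∈ fields D) λ f∈ → s ∈ᴿ F D r′ f f∈

      InF⁺ : Cls → Reg → Fld → Reg → Set
      InF⁺ C r f s = s ≡ Null ⊎ ∃₂ λ D r′ → Origin C r f s D r′

      ∃Reg? : ∀ {Q : Pred Reg 0ℓ} → (∀ r → Dec (Q r)) → Dec (∃ Q)
      ∃Reg? Q? = map′ satisfied (λ (r , q) → lose (∈-regions r) q) (anyᴸ? Q? regions)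

      inF⁺? : ∀ C r f s → Dec (InF⁺ C r f s)
      inF⁺? C r f s = (s ≟ᴿ Null) ⊎-dec any? λ D → ∃Reg? λ r′ →
        ((r′ ≟ᴿ r) ⊎-dec (r ≟ᴿ Unknown)) ×-dec (linked? f C D ×-dec
          Σ-dec-irr (f ∈? fields D) λ f∈ → T? (F D r′ f f∈ s))

      F⁺ : FieldTyping
      F⁺ C r f _ s = ⌊ inF⁺? C r f s ⌋

      entry : ∀ {C m} → Reg → Vec Reg (ar m) → ∀ D → Dec (D ⪯ C) → Dec (m ∈ methods D) → Effect
      entry {m = m} r ss D (yes _) (yes m∈) = M (sig D r m m∈ ss)
      entry         r ss D _       _        = ∅ᵉ

      M⁺ : MethodTyping
      M⁺ (sig C r m _ ss) =
        ⨆ᵉ (λ D → entry r ss D (D ⪯? C) (m ∈? methods D)) (allFin #Cls)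

      F⁺-sound : ∀ {C r f s} .(f∈ : f ∈ fields C) → s ∈ᴿ F⁺ C r f f∈ → InF⁺ C r f s
      F⁺-sound {C} {r} {f} {s} _ = toWitness {a? = inF⁺? C r f s}

      F⁺-complete : ∀ {C r f s} .(f∈ : f ∈ fields C) → InF⁺ C r f s → s ∈ᴿ F⁺ C r f f∈
      F⁺-complete {C} {r} {f} {s} _ = fromWitness {a? = inF⁺? C r f s}

      entry-upper : ∀ {C m} r ss D (p? : Dec (D ⪯ C)) (q? : Dec (m ∈ methods D)) →
        D ⪯ C → .(q : m ∈ methods D) → M (sig D r m q ss) ⊑ᵉ entry r ss D p? q?
      entry-upper r ss D (yes _) (yes _) p q = ⊑ᵉ-refl
      entry-upper r ss D (yes _) (no ¬q) p q = ⊥-elim-irr (¬q q)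
      entry-upper r ss D (no ¬p) _       p q = contradiction p ¬p

      entry-least : ∀ {C m X} r ss D (p? : Dec (D ⪯ C)) (q? : Dec (m ∈ methods D)) →
        (D ⪯ C → (q : m ∈ methods D) → M (sig D r m q ss) ⊑ᵉ X) → entry r ss D p? q? ⊑ᵉ X
      entry-least r ss D (yes p) (yes q) least = least p q
      entry-least r ss D (yes _) (no _)  least = ∅ᵉ-least
      entry-least r ss D (no _)  (yes _) least = ∅ᵉ-least
      entry-least r ss D (no _)  (no _)  least = ∅ᵉ-least

      M⁺-upper : ∀ {C D} r m .(p : m ∈ methods C) .(q : m ∈ methods D) ss →
        D ⪯ C → M (sig D r m q ss) ⊑ᵉ M⁺ (sig C r m p ss)
      M⁺-upper {C} {D} r m p q ss D⪯C = ⊑ᵉ-trans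
        (entry-upper r ss D (D ⪯? C) (m ∈? methods D) D⪯C q)
        (⨆ᵉ-upper _ (∈-allFin D))

      M⁺-least : ∀ {C X} r m .(p : m ∈ methods C) ss →
        (∀ D → D ⪯ C → (q : m ∈ methods D) → M (sig D r m q ss) ⊑ᵉ X) →
        M⁺ (sig C r m p ss) ⊑ᵉ X
      M⁺-least {C} r m p ss least = ⨆ᵉ-least _ (allFin #Cls) λ D →
        entry-least r ss D (D ⪯? C) (m ∈? methods D) (least D)

      F⁺-step : ∀ {C D r f} → LinkStep f C D → .(p : f ∈ fields C) .(q : f ∈ fields D) →
        F⁺ D r f q ⊆ᴿ F⁺ C r f p
      F⁺-step step p q s s∈ with F⁺-sound q s∈
      ... | inj₁ eq                         = F⁺-complete p (inj₁ eq)
      ... | inj₂ (E , r′ , reg , link , s∈E) =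
        F⁺-complete p (inj₂ (E , r′ , reg , step ◅ link , s∈E))

      wellFormed : WellFormed (F⁺ , M⁺)
      wellFormed = record
        { F-Null    = λ C r f f∈ → F⁺-complete {r = r} f∈ (inj₁ refl)
        ; F-Unknown = λ C r f f∈ s s∈ → F⁺-complete f∈ (widen (F⁺-sound f∈ s∈))
        ; F-inv     = λ {C} {D} C⪯D r f p q →
            let p′ = recompute (f ∈? fields C) p
                q′ = recompute (f ∈? fields D) q
            in F⁺-step (q′ , p′ , inj₂ C⪯D) q p , F⁺-step (p′ , q′ , inj₁ C⪯D) p q
        ; M-mono    = λ C⪯D r m p q ss → M⁺-least r m p ss λ E E⪯C e →
            M⁺-upper r m q e ss (E⪯C ◅◅ C⪯D)
        }
        where
        widen : ∀ {C r f s} → InF⁺ C r f s → InF⁺ C Unknown f s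
        widen (inj₁ eq)                        = inj₁ eq
        widen (inj₂ (D , r′ , _ , link , s∈)) = inj₂ (D , r′ , inj₂ refl , link , s∈)

      above : (F , M) ≼ (F⁺ , M⁺)
      above =
        (λ C r f f∈ s s∈ → F⁺-complete f∈
          (inj₂ (C , r , inj₁ refl , done , recompute (f ∈? fields C) f∈ , s∈))) ,
        (λ { (sig C r m m∈ ss) → M⁺-upper r m m∈ m∈ ss done })

      least : ∀ t → WellFormed t → (F , M) ≼ t → (F⁺ , M⁺) ≼ t
      least (F′ , M′) wf (F≼ , M≼) =
        (λ C r f f∈ s s∈ → F-least (recompute (f ∈? fields C) f∈) (F⁺-sound f∈ s∈)) ,
        (λ { (sig C r m m∈ ss) → M⁺-least r m m∈ ss λ D D⪯C q →
               ⊑ᵉ-trans (M≼ (sig D r m q ss)) (M-mono D⪯C r m q m∈ ss) })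
        where
        open WellFormed wf
        along : ∀ {C D r f s} → Linked f C D → .(p : f ∈ fields C) .(q : f ∈ fields D) →
          s ∈ᴿ F′ D r f q → s ∈ᴿ F′ C r f p
        along done p q s∈ = s∈
        along ((_ , e , inj₁ C⪯E) ◅ link) p q s∈ =
          proj₂ (F-inv C⪯E _ _ p e) _ (along link e q s∈)
        along ((_ , e , inj₂ E⪯C) ◅ link) p q s∈ =
          proj₁ (F-inv E⪯C _ _ e p) _ (along link e q s∈)

        F-least : ∀ {C r f s} (f∈ : f ∈ fields C) → InF⁺ C r f s → s ∈ᴿ F′ C r f f∈
        F-least f∈ (inj₁ refl) = F-Null _ _ _ f∈
        F-least f∈ (inj₂ (D , r , inj₁ refl , link , q , s∈)) =
          along link f∈ q (F≼ D r _ q _ s∈)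
        F-least f∈ (inj₂ (D , r , inj₂ refl , link , q , s∈)) =
          along link f∈ q (F-Unknown D r _ q _ (F≼ D r _ q _ s∈))

    leastWellFormedAbove : ∀ t → ∃ (IsLeastWellFormedAbove t)
    leastWellFormedAbove (F , M) = (F⁺ , M⁺) , wellFormed , above , least
      where open Closure F M

    checkClassTable : Table → Table
    checkClassTable t = proj₁ (leastWellFormedAbove t)

    process : Sig → Table → Maybe Table
    process σ@(sig C r m m∈ ss) (F , M) =
      let (xs , e) = mtable C m m∈ in
      if does (C ∈Cls? r)
        then (do
          (E , F′) ← typeff M (methodEnv r xs ss) e F
          just (checkClassTable (F′ , M [ σ ]⊔ E)))
        else just (F , M)

    round : List Sig → Table → Maybe Table
    round []       t = just t
    round (σ ∷ σs) t = do
      t′ ← process σ t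
      round σs t′

    initial : Table
    initial = (λ _ _ _ _ → ⁅ Null ⁆ᴿ) , (λ _ → ∅ᵉ)

    -- Repeat σs t t′: repeating rounds from t, each of which visits the
    -- signatures in the order σs, terminates with t′.
    data Repeat (σs : List Sig) (t : Table) : Table → Set where
      stop  : ∀ {t′} → round σs t ≡ just t′ → t′ ≋ t → Repeat σs t t′
      again : ∀ {t′ t″} → round σs t ≡ just t′ → ¬ (t′ ≋ t) → Repeat σs t′ t″ → Repeat σs t t″

    𝒜[_]⇓_ : List Sig → Table → Set
    𝒜[ σs ]⇓ t = Repeat σs initial t

{-# OPTIONS --safe #-}
module Submission where

-- Standard typability ensures that no lookup of the inference fails, as failure
-- depends only on the domain of the environment and on static classes. Rounds
-- only enlarge the table, and tables form a finite order, so the iteration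
-- stops. In its last round all intermediate tables coincide up to ≋, so every
-- effect computed in that round is derivable for the resulting table, and the
-- entry of the signature lies above it.

open import Defs
open import Data.Bool using (true; false; if_then_else_; T; _∧_)
open import Data.Bool.Properties using (T?; T-∨)
open import Data.Empty using (⊥-elim)
open import Data.Fin.Properties using () renaming (_≟_ to _≟ᶠ_)
open import Data.Fin.Subset using (_∈_)
open import Data.Fin.Subset.Properties using (_∈?_)
open import Data.List using (List; []; _∷_; _++_; map; filter; foldr; length; allFin; cartesianProduct)
open import Data.List.Membership.Propositional using (find) renaming (_∈_ to _∈ᴸ_)
open import Data.List.Membership.Propositional.Properties
  using (∈-allFin; ∈-map⁺; ∈-++⁺ˡ; ∈-++⁺ʳ; ∈-cartesianProduct⁺; ∈-filter⁺; ∈-filter⁻)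
open import Data.List.Relation.Binary.Pointwise using (Pointwise-≡⇒≡)
open import Data.List.Relation.Binary.Sublist.Propositional using (_⊆_; ⊆-refl)
open import Data.List.Relation.Binary.Sublist.Propositional.Properties using (filter⁺; length-mono-≤)
open import Data.List.Relation.Binary.Sublist.Heterogeneous.Properties using (toPointwise)
open import Data.List.Relation.Unary.Any using (here; there)
open import Data.List.Relation.Unary.Enumerates.Setoid using (IsEnumeration)
open import Data.Maybe using (Maybe; just; nothing; _>>=_)
open import Data.Maybe.Properties using (just-injective)
open import Data.Nat using (ℕ; suc; _<_; _≤_)
open import Data.Nat.Induction using (<-wellFounded)
open import Data.Nat.Properties using (≤∧≢⇒<; ≤-antisym) renaming (_≟_ to _≟ᴺ_)
open import Data.Product using (Σ; ∃; _×_; _,_; proj₁; proj₂)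
open import Data.Sum using (_⊎_; inj₁; inj₂; [_,_]′)
open import Data.Vec using (Vec; []; _∷_)
open import Data.Vec.Relation.Binary.Pointwise.Inductive using (Pointwise; []; _∷_)
open import Function using (_∘_; id; Equivalence)
open import Induction.WellFounded using (Acc; acc)
open import Level using (0ℓ)
open import Relation.Binary.Lattice.Properties.JoinSemilattice using (≈-dec⇒≤-dec)
open import Relation.Binary.PropositionalEquality using (_≡_; refl; sym; trans; subst; setoid)
open import Relation.Nullary using (¬_; Dec; yes; no; does)
open import Relation.Nullary.Decidable using (dec⇒maybe; dec-true; recompute; ¬?; decidable-stable)
open import Relation.Nullary.Negation using (contradiction)
open import Relation.Unary using (Pred; Decidable)

Defined : {A : Set} → Pred (Maybe A) 0ℓ
Defined m = ∃ λ a → m ≡ just a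

>>=-defined : {A B : Set} {m : Maybe A} {f : A → Maybe B} →
  Defined m → (∀ a → Defined (f a)) → Defined (m >>= f)
>>=-defined (a , refl) f-defined = f-defined a

>>=-just⁻ : {A B : Set} (m : Maybe A) {f : A → Maybe B} {b : B} →
  (m >>= f) ≡ just b → ∃ λ a → m ≡ just a × f a ≡ just b
>>=-just⁻ (just a) eq = a , refl , eq

dec⇒maybe-defined : {A : Set} (A? : Dec A) → A → Defined (dec⇒maybe A?)
dec⇒maybe-defined (yes a) _ = a , refl
dec⇒maybe-defined (no ¬a) a = contradiction a ¬a

if-does⁻ : {A B : Set} (A? : Dec A) {x y z : B} →
  (if does A? then x else y) ≡ z → A × x ≡ z ⊎ ¬ A × y ≡ z
if-does⁻ (yes a) eq = inj₁ (a , eq)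
if-does⁻ (no ¬a) eq = inj₂ (¬a , eq)

if-does-defined : {A B : Set} (A? : Dec A) {x y : Maybe B} →
  (A → Defined x) → Defined y → Defined (if does A? then x else y)
if-does-defined (yes a) x-defined y-defined = x-defined a
if-does-defined (no _)  x-defined y-defined = y-defined

module _ {A : Set} {P Q : Pred A 0ℓ} (P? : Decidable P) (Q? : Decidable Q) (P⇒Q : ∀ {x} → P x → Q x) where

  filter-⊆ : ∀ xs → filter P? xs ⊆ filter Q? xs
  filter-⊆ xs = filter⁺ P? Q? (λ { refl → P⇒Q }) (⊆-refl {x = xs})

  length-filter-≤ : ∀ xs → length (filter P? xs) ≤ length (filter Q? xs)
  length-filter-≤ xs = length-mono-≤ (filter-⊆ xs)

  length-filter-≡ : ∀ {xs} → length (filter P? xs) ≡ length (filter Q? xs) →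
    ∀ {x} → x ∈ᴸ xs → Q x → P x
  length-filter-≡ {xs} eq x∈ q = proj₂ (∈-filter⁻ P? {xs = xs}
    (subst (_ ∈ᴸ_) (sym (Pointwise-≡⇒≡ (toPointwise eq (filter-⊆ xs)))) (∈-filter⁺ Q? x∈ q)))

module _ {Letter : Set} {N : Names} where
  open Names N
  open FJ Letter N

  infix 4 _Covers_
  record _Covers_ {A B : Set} (Γ : Env A) (Δ : Env B) : Set where
    field defined : ∀ {x b} → Δ x ≡ just b → Defined (Γ x)
  open _Covers_

  ∅-covers : {A B : Set} → _Covers_ {A} {B} (λ _ → nothing) (λ _ → nothing)
  ∅-covers .defined ()

  covers-extend : {A B : Set} {Γ : Env A} {Δ : Env B} → Γ Covers Δ →
    ∀ x a b → Γ [ x ↦ a ] Covers Δ [ x ↦ b ]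
  covers-extend cov x a b .defined {y} eq with does (y ≟ⱽ x)
  ... | true  = a , refl
  ... | false = cov .defined eq

  -- The local function of methodEnv, lifted over the arguments of methodEnv.
  -- It cannot be named, but once those arguments are abstracted in
  -- methodEnv-∷ it is applied to distinct variables, and unification finds it.
  mutual
    bind : {A : Set} {n : ℕ} → A → Vec Var n → Vec A n →
      {k : ℕ} → Vec Var k → Vec A k → Env A → Env A
    bind = _

    methodEnv-∷ : {A : Set} {n : ℕ} (c : A) (x : Var) (xs : Vec Var n) (v : A) (vs : Vec A n) →
      methodEnv c (x ∷ xs) (v ∷ vs) ≡
      bind c (x ∷ xs) (v ∷ vs) xs vs (((λ _ → nothing) [ this ↦ c ]) [ x ↦ v ])
    methodEnv-∷ {n = n} c x xs v vs
      with suc n | x ∷ xs | v ∷ vs | _[_↦_] ((λ _ → nothing) [ this ↦ c ]) x v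
    ... | _ | _ | _ | _ = refl

  module _ {A B : Set} {n} (a : A) (b : B) (xs : Vec Var n) (as : Vec A n) (bs : Vec B n) where

    bind-covers : ∀ {k Γ Δ} (ys : Vec Var k) vs ws → Γ Covers Δ →
      bind a xs as ys vs Γ Covers bind b xs bs ys ws Δ
    bind-covers []       []       []       cov = cov
    bind-covers (y ∷ ys) (v ∷ vs) (w ∷ ws) cov = bind-covers ys vs ws (covers-extend cov y v w)

    methodEnv-covers : methodEnv a xs as Covers methodEnv b xs bs
    methodEnv-covers = bind-covers xs as bs (covers-extend ∅-covers this a b)

  module _ (𝔅 : BüchiAbstraction Letter) (P : Program) where
    open Program P
    open BüchiAbstraction 𝔅
    open Inference 𝔅 P
    open Standard P using (ClassTable) renaming (_⊢_∶_ to StandardTyping; WellTyped to StandardWellTyped)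

    lookupAll-pointwise : ∀ {A : Set} {Γ : Env A} {n} (ys : Vec Var n) {vs} →
      lookupAll Γ ys ≡ just vs → Pointwise (λ y v → Γ y ≡ just v) ys vs
    lookupAll-pointwise []       refl = []
    lookupAll-pointwise {Γ = Γ} (y ∷ ys) eq with >>=-just⁻ (Γ y) eq
    ... | v , eqv , eq′ with >>=-just⁻ (lookupAll Γ ys) eq′
    ... | vs , eqvs , refl = eqv ∷ lookupAll-pointwise ys eqvs

    module _ {𝒯 : ClassTable} where
      var-defined : ∀ {A : Set} {Γ : Env A} {Δ x C} → StandardTyping 𝒯 Δ (var x) C → Γ Covers Δ → Defined (Γ x)
      var-defined (Standard.sub d _) cov = var-defined d cov
      var-defined (Standard.var eq)  cov = cov .defined eq

      lookupAll-defined : ∀ {A : Set} {Γ : Env A} {Δ n} {ys : Vec Var n} {Cs : Vec Cls n} →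
        Pointwise (λ y → StandardTyping 𝒯 Δ (var y)) ys Cs → Γ Covers Δ → Defined (lookupAll Γ ys)
      lookupAll-defined []       cov = [] , refl
      lookupAll-defined (d ∷ ds) cov =
        >>=-defined (var-defined d cov) λ _ → >>=-defined (lookupAll-defined ds cov) λ _ → _ , refl

      branches-defined : ∀ X {body} → (∀ r F → Defined (body r F)) → ∀ rs F → Defined (branches X body rs F)
      branches-defined X body-defined []       F = _ , refl
      branches-defined X body-defined (r ∷ rs) F with X r
      ... | nothing = branches-defined X body-defined rs F
      ... | just U  = >>=-defined (body-defined r F) λ (_ , F₁) →
        >>=-defined (branches-defined X body-defined rs F₁) λ _ → _ , refl

      typeff-defined : ∀ {M Γ Δ e C} → StandardTyping 𝒯 Δ e C → Γ Covers Δ → ∀ F → Defined (typeff M Γ e F)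
      typeff-defined (Standard.sub d _) cov F = typeff-defined d cov F
      typeff-defined (Standard.var eq)  cov F = >>=-defined (cov .defined eq) λ _ → _ , refl
      typeff-defined Standard.null      cov F = _ , refl
      typeff-defined Standard.emit      cov F = _ , refl
      typeff-defined Standard.new       cov F = _ , refl
      typeff-defined (Standard.cast d)  cov F = typeff-defined d cov F
      typeff-defined (Standard.letin {x = x} d₁ d₂) cov F =
        >>=-defined (typeff-defined d₁ cov F) λ ((R , _) , F₁) →
        >>=-defined
          (branches-defined R (λ r → typeff-defined d₂ (covers-extend cov x r _)) regions F₁)
          λ _ → _ , refl
      typeff-defined (Standard.ifeq dx dy d₁ d₂) cov F =
        >>=-defined (var-defined dx cov) λ r → >>=-defined (var-defined dy cov) λ s →
        if-does-defined (disjoint? r s) (λ _ → typeff-defined d₂ cov F)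
          (>>=-defined (typeff-defined d₁ cov F) λ (_ , F₁) →
           >>=-defined (typeff-defined d₂ cov F₁) λ _ → _ , refl)
      typeff-defined (Standard.get f∈ dx) cov F =
        >>=-defined (var-defined dx cov) λ _ →
        >>=-defined (dec⇒maybe-defined (_ ∈? _) f∈) λ _ → _ , refl
      typeff-defined (Standard.set f∈ dx dy) cov F =
        >>=-defined (var-defined dx cov) λ _ → >>=-defined (var-defined dy cov) λ _ →
        >>=-defined (dec⇒maybe-defined (_ ∈? _) f∈) λ _ → _ , refl
      typeff-defined (Standard.call m∈ dx dys) cov F =
        >>=-defined (var-defined dx cov) λ _ → >>=-defined (lookupAll-defined dys cov) λ _ →
        >>=-defined (dec⇒maybe-defined (_ ∈? _) m∈) λ _ → _ , refl

      module _ (wellTyped : StandardWellTyped 𝒯) where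

        process-defined : ∀ σ t → Defined (process σ t)
        process-defined (sig C r m m∈ ss) (F , M) = if-does-defined (C ∈Cls? r)
          (λ _ → >>=-defined
            (typeff-defined (wellTyped C m (recompute (m ∈? methods C) m∈))
              (methodEnv-covers r C (proj₁ (mtable C m m∈)) ss _) F)
            λ _ → _ , refl)
          (_ , refl)

        round-defined : ∀ σs t → Defined (round σs t)
        round-defined []       t = t , refl
        round-defined (σ ∷ σs) t = >>=-defined (process-defined σ t) (round-defined σs)

    infix 4 _⊆ᶠ_
    _⊆ᶠ_ : FieldTyping → FieldTyping → Set
    F ⊆ᶠ F′ = ∀ C r f .(f∈ : f ∈ fields C) → F C r f f∈ ⊆ᴿ F′ C r f f∈

    ⊆ᶠ-refl : ∀ {F} → F ⊆ᶠ F
    ⊆ᶠ-refl C r f f∈ s = id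

    ⊆ᶠ-trans : ∀ {F G H} → F ⊆ᶠ G → G ⊆ᶠ H → F ⊆ᶠ H
    ⊆ᶠ-trans p q C r f f∈ s = q C r f f∈ s ∘ p C r f f∈ s

    ≼-refl : ∀ {t} → t ≼ t
    ≼-refl = ⊆ᶠ-refl , λ _ → ⊑ᵉ-refl

    ≼-trans : ∀ {t u v} → t ≼ u → u ≼ v → t ≼ v
    ≼-trans (p , q) (p′ , q′) = ⊆ᶠ-trans p p′ , λ σ → ⊑ᵉ-trans (q σ) (q′ σ)

    []∪-increases : ∀ F C r f s → F ⊆ᶠ F [ C , r , f ]∪ s
    []∪-increases F C r f s C′ r′ f′ f∈ s′ s′∈
      with does (C′ ≟ᶠ C) ∧ does (r′ ≟ᴿ r) ∧ does (f′ ≟ᶠ f)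
    ... | true  = Equivalence.from T-∨ (inj₁ s′∈)
    ... | false = s′∈

    []∪-contains : ∀ F C r f s .(f∈ : f ∈ fields C) → s ∈ᴿ (F [ C , r , f ]∪ s) C r f f∈
    []∪-contains F C r f s f∈
      rewrite dec-true (C ≟ᶠ C) refl | dec-true (r ≟ᴿ r) refl | dec-true (f ≟ᶠ f) refl =
      Equivalence.from (T-∨ {F C r f f∈ s}) (inj₂ (subst T (sym (dec-true (s ≟ᴿ s) refl)) _))

    branches-increases : ∀ X {body} → (∀ r {F E F′} → body r F ≡ just (E , F′) → F ⊆ᶠ F′) →
      ∀ rs {F E F′} → branches X body rs F ≡ just (E , F′) → F ⊆ᶠ F′
    branches-increases X increases []       refl = ⊆ᶠ-refl
    branches-increases X {body} increases (r ∷ rs) {F} eq with X r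
    ... | nothing = branches-increases X increases rs eq
    ... | just U with >>=-just⁻ (body r F) eq
    ... | (_ , F₁) , eq₁ , eq′ with >>=-just⁻ (branches X body rs F₁) eq′
    ... | _ , eq₂ , refl = ⊆ᶠ-trans (increases r eq₁) (branches-increases X increases rs eq₂)

    typeff-increases : ∀ {M Γ} e {F E F′} → typeff M Γ e F ≡ just (E , F′) → F ⊆ᶠ F′
    typeff-increases {M} {Γ} (var x) eq with >>=-just⁻ (Γ x) eq
    ... | _ , _ , refl = ⊆ᶠ-refl
    typeff-increases {M} {Γ} (letin x e₁ e₂) {F} eq with >>=-just⁻ (typeff M Γ e₁ F) eq
    ... | ((R , S) , F₁) , eq₁ , eq′ with >>=-just⁻ (branches R _ regions F₁) eq′
    ... | _ , eq₂ , refl = ⊆ᶠ-trans (typeff-increases e₁ eq₁)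
      (branches-increases R (λ r → typeff-increases e₂) regions eq₂)
    typeff-increases {M} {Γ} (ifeq x y e₁ e₂) {F} eq with >>=-just⁻ (Γ x) eq
    ... | r , _ , eq′ with >>=-just⁻ (Γ y) eq′
    ... | s , _ , eq″ with if-does⁻ (disjoint? r s) eq″
    ... | inj₁ (_ , eq₂) = typeff-increases e₂ eq₂
    ... | inj₂ (_ , eq‴) with >>=-just⁻ (typeff M Γ e₁ F) eq‴
    ... | (_ , F₁) , eq₁ , eq⁗ with >>=-just⁻ (typeff M Γ e₂ F₁) eq⁗
    ... | _ , eq₂ , refl = ⊆ᶠ-trans (typeff-increases e₁ eq₁) (typeff-increases e₂ eq₂)
    typeff-increases null refl = ⊆ᶠ-refl
    typeff-increases (new ℓ C _) refl = ⊆ᶠ-refl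
    typeff-increases (cast D _ e) eq = typeff-increases e eq
    typeff-increases (emit a) refl = ⊆ᶠ-refl
    typeff-increases {M} {Γ} (call x C m ys) eq with >>=-just⁻ (Γ x) eq
    ... | _ , _ , eq′ with >>=-just⁻ (lookupAll Γ ys) eq′
    ... | _ , _ , eq″ with >>=-just⁻ (dec⇒maybe (m ∈? methods C)) eq″
    ... | _ , _ , refl = ⊆ᶠ-refl
    typeff-increases {M} {Γ} (get x C f) eq with >>=-just⁻ (Γ x) eq
    ... | _ , _ , eq′ with >>=-just⁻ (dec⇒maybe (f ∈? fields C)) eq′
    ... | _ , _ , refl = ⊆ᶠ-refl
    typeff-increases {M} {Γ} (set x C f y) eq with >>=-just⁻ (Γ x) eq
    ... | r , _ , eq′ with >>=-just⁻ (Γ y) eq′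
    ... | s , _ , eq″ with >>=-just⁻ (dec⇒maybe (f ∈? fields C)) eq″
    ... | _ , _ , refl = []∪-increases _ C r f s

    ⊔ᵖ-upperˡ : ∀ {K} (X Y : M⟨ K ⟩) → X ⊑ X ⊔ᵖ Y
    ⊔ᵖ-upperˡ X Y k = ⊔ᵐ-upperˡ (X k) (Y k)

    ⊔ᵖ-upperʳ : ∀ {K} (X Y : M⟨ K ⟩) → Y ⊑ X ⊔ᵖ Y
    ⊔ᵖ-upperʳ X Y k = ⊔ᵐ-upperʳ (X k) (Y k)

    -- The step function of the fold in ⨆, which is local to ⨆. If the first two
    -- summands are absent, ⨆ reduces to a fold that is stuck, where unification
    -- finds the step function.
    mutual
      step : ∀ {K} → M⟨ Reg ⟩ → (Reg → M⟨ K ⟩) → Reg → M⟨ K ⟩ → M⟨ K ⟩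
      step = _

      ⨆-without-Null-Unknown : ∀ {K} (X : M⟨ Reg ⟩) (Y : Reg → M⟨ K ⟩) k →
          X Null ≡ nothing → X Unknown ≡ nothing →
        ⨆ X Y k ≡ foldr (step X Y) ∅ᵖ (map CreatedAt (allFin #Pos)) k
      ⨆-without-Null-Unknown X Y k eq eq′ rewrite eq | eq′ = refl

    module _ {K} (X : M⟨ Reg ⟩) (Y : Reg → M⟨ K ⟩) (Z : M⟨ K ⟩)
      (upper : ∀ {r U} → X r ≡ just U → U ·ᵖ Y r ⊑ Z) where

      step-least : ∀ r W → W ⊑ Z → step X Y r W ⊑ Z
      step-least r W W⊑Z k with X r in eq
      ... | nothing = W⊑Z k
      ... | just U  = ⊔ᵐ-least ((U ·ᵖ Y r) k) (W k) (upper eq k) (W⊑Z k)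

      foldr-step-least : ∀ rs → foldr (step X Y) ∅ᵖ rs ⊑ Z
      foldr-step-least []       k = ⊥*-least _
      foldr-step-least (r ∷ rs) k = step-least r (foldr (step X Y) ∅ᵖ rs) (foldr-step-least rs) k

      ⨆-least : ⨆ X Y ⊑ Z
      ⨆-least = foldr-step-least regions

    &ε-mono : ∀ {A B} → A ⊆ᴿ B → A &ε ⊑ B &ε
    &ε-mono {A} {B} A⊆B s with A s | B s | A⊆B s
    ... | false | _     | _    = ⊥*-least _
    ... | true  | true  | _    = M*.refl
    ... | true  | false | A⊆B′ = ⊥-elim (A⊆B′ _)

    branches-sound : ∀ X {body} {Q : Reg → Effect → Set} {G} →
      (∀ r {F E F′} → body r F ≡ just (E , F′) → F ⊆ᶠ F′) →
      (∀ r {F E F′} → body r F ≡ just (E , F′) → G ⊆ᶠ F → F′ ⊆ᶠ G → Q r E) →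
      ∀ rs {F T S F′} → branches X body rs F ≡ just ((T , S) , F′) → G ⊆ᶠ F → F′ ⊆ᶠ G →
      ∀ {r} → r ∈ᴸ rs → ∃ λ E → ∀ {U} → X r ≡ just U → Q r E × U ·ᵖ proj₁ E ⊑ T × U ·ᵖ proj₂ E ⊑ S
    branches-sound X {body} increases sound (r ∷ rs) {F} eq G⊆F F′⊆G r′∈ with X r in eqᵣ
    branches-sound X {body} increases sound (r ∷ rs) {F} eq G⊆F F′⊆G (here refl) | nothing =
      ∅ᵉ , λ eqᵣ′ → contradiction (trans (sym eqᵣ) eqᵣ′) λ ()
    branches-sound X {body} increases sound (r ∷ rs) {F} eq G⊆F F′⊆G (there r′∈) | nothing =
      branches-sound X increases sound rs eq G⊆F F′⊆G r′∈
    ... | just U with >>=-just⁻ (body r F) eq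
    ... | (E , F₁) , eq₁ , eq′ with >>=-just⁻ (branches X body rs F₁) eq′
    ... | (E′ , _) , eq₂ , refl with r′∈
    ... | here refl = E , λ eqᵣ′ → head (just-injective (trans (sym eqᵣ) eqᵣ′))
      where
      head : ∀ {U′} → U ≡ U′ → _
      head refl =
        sound r eq₁ G⊆F (⊆ᶠ-trans (branches-increases X increases rs eq₂) F′⊆G) ,
        ⊔ᵖ-upperˡ (U ·ᵖ proj₁ E) (proj₁ E′) , ⊔ᵖ-upperˡ (U ·ᵖ proj₂ E) (proj₂ E′)
    ... | there r′∈′ with branches-sound X increases sound rs eq₂ (⊆ᶠ-trans G⊆F (increases r eq₁)) F′⊆G r′∈′
    ... | E″ , typed = E″ , λ eqᵣ′ → let (q , T⊑ , S⊑) = typed eqᵣ′ in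
      q ,
      (λ k → M*.trans (T⊑ k) (⊔ᵖ-upperʳ (U ·ᵖ proj₁ E) (proj₁ E′) k)) ,
      (λ k → M*.trans (S⊑ k) (⊔ᵖ-upperʳ (U ·ᵖ proj₂ E) (proj₂ E′) k))

    -- get and call ask that t lie below the table that typeff reads, set that t
    -- lie above the table that it writes.
    typeff-sound : ∀ {t M Γ} e {F T S F′} → typeff M Γ e F ≡ just ((T , S) , F′) →
      proj₁ t ⊆ᶠ F → F′ ⊆ᶠ proj₁ t → (∀ σ → proj₂ t σ ⊑ᵉ M σ) →
      _⊢_∶_calls_ t Γ e T S
    typeff-sound {Γ = Γ} (var x) eq G⊆F F′⊆G N⊑M with >>=-just⁻ (Γ x) eq
    ... | _ , eqx , refl = var eqx
    typeff-sound {t} {M} {Γ} (letin x e₁ e₂) {F} eq G⊆F F′⊆G N⊑M with >>=-just⁻ (typeff M Γ e₁ F) eq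
    ... | ((R , S) , F₁) , eq₁ , eq′ with >>=-just⁻ (branches R _ regions F₁) eq′
    ... | ((T′ , S′) , _) , eq₂ , refl = sub
        (letin (typeff-sound e₁ eq₁ G⊆F (⊆ᶠ-trans (branches-increases R increases regions eq₂) F′⊆G) N⊑M)
          λ {r} eqᵣ → proj₁ (proj₂ (branch r) eqᵣ))
        (⨆-least R _ T′ λ {r} eqᵣ → proj₁ (proj₂ (proj₂ (branch r) eqᵣ)))
        (λ k → ⊔ᵐ-least (S k) _ (⊔ᵖ-upperˡ S S′ k)
          (M*.trans (⨆-least R _ S′ (λ {r} eqᵣ → proj₂ (proj₂ (proj₂ (branch r) eqᵣ))) k) (⊔ᵖ-upperʳ S S′ k)))
      where
      increases : ∀ r {F E F′} → typeff M (Γ [ x ↦ r ]) e₂ F ≡ just (E , F′) → F ⊆ᶠ F′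
      increases r = typeff-increases e₂

      branch : ∀ r → ∃ λ E → ∀ {U} → R r ≡ just U →
        _⊢_∶_calls_ t (Γ [ x ↦ r ]) e₂ (proj₁ E) (proj₂ E) × U ·ᵖ proj₁ E ⊑ T′ × U ·ᵖ proj₂ E ⊑ S′
      branch r = branches-sound R
        {Q = λ r E → _⊢_∶_calls_ t (Γ [ x ↦ r ]) e₂ (proj₁ E) (proj₂ E)} increases
        (λ r eq G⊆ ⊆G → typeff-sound e₂ eq G⊆ ⊆G N⊑M) regions eq₂
        (⊆ᶠ-trans G⊆F (typeff-increases e₁ eq₁)) F′⊆G (∈-regions r)
    typeff-sound {t} {M} {Γ} (ifeq x y e₁ e₂) {F} eq G⊆F F′⊆G N⊑M with >>=-just⁻ (Γ x) eq
    ... | r , eqx , eq′ with >>=-just⁻ (Γ y) eq′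
    ... | s , eqy , eq″ with if-does⁻ (disjoint? r s) eq″
    ... | inj₁ (disjoint , eq₂) = else eqx eqy disjoint (typeff-sound e₂ eq₂ G⊆F F′⊆G N⊑M)
    ... | inj₂ (_ , eq‴) with >>=-just⁻ (typeff M Γ e₁ F) eq‴
    ... | (_ , F₁) , eq₁ , eq⁗ with >>=-just⁻ (typeff M Γ e₂ F₁) eq⁗
    ... | _ , eq₂ , refl = if eqx eqy
      (typeff-sound e₁ eq₁ G⊆F (⊆ᶠ-trans (typeff-increases e₂ eq₂) F′⊆G) N⊑M)
      (typeff-sound e₂ eq₂ (⊆ᶠ-trans G⊆F (typeff-increases e₁ eq₁)) F′⊆G N⊑M)
    typeff-sound null refl G⊆F F′⊆G N⊑M = null
    typeff-sound (new ℓ C _) refl G⊆F F′⊆G N⊑M = new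
    typeff-sound (cast D _ e) eq G⊆F F′⊆G N⊑M = cast (typeff-sound e eq G⊆F F′⊆G N⊑M)
    typeff-sound (emit a) refl G⊆F F′⊆G N⊑M = prim
    typeff-sound {Γ = Γ} (call x C m ys) eq G⊆F F′⊆G N⊑M with >>=-just⁻ (Γ x) eq
    ... | r , eqx , eq′ with >>=-just⁻ (lookupAll Γ ys) eq′
    ... | ss , eqys , eq″ with >>=-just⁻ (dec⇒maybe (m ∈? methods C)) eq″
    ... | m∈ , _ , refl = sub (call m∈ eqx (lookupAll-pointwise ys eqys)) (type-⊑ (N⊑M _)) λ _ → M*.refl
    typeff-sound {Γ = Γ} (get x C f) eq G⊆F F′⊆G N⊑M with >>=-just⁻ (Γ x) eq
    ... | r , eqx , eq′ with >>=-just⁻ (dec⇒maybe (f ∈? fields C)) eq′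
    ... | f∈ , _ , refl = sub (get f∈ eqx) (&ε-mono (G⊆F C r f f∈)) λ _ → M*.refl
    typeff-sound {Γ = Γ} (set x C f y) {F} eq G⊆F F′⊆G N⊑M with >>=-just⁻ (Γ x) eq
    ... | r , eqx , eq′ with >>=-just⁻ (Γ y) eq′
    ... | s , eqy , eq″ with >>=-just⁻ (dec⇒maybe (f ∈? fields C)) eq″
    ... | f∈ , _ , refl = set f∈ eqx eqy (F′⊆G C r f f∈ s ([]∪-contains F C r f s f∈))

    checkClassTable-wellFormed : ∀ t → WellFormed (checkClassTable t)
    checkClassTable-wellFormed t = proj₁ (proj₂ (leastWellFormedAbove t))

    checkClassTable-increases : ∀ t → t ≼ checkClassTable t
    checkClassTable-increases t = proj₁ (proj₂ (proj₂ (leastWellFormedAbove t)))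

    []⊔-increases : ∀ M σ E τ → M τ ⊑ᵉ (M [ σ ]⊔ E) τ
    []⊔-increases M σ E τ with does (τ ≟ˢ σ)
    ... | true  = ⊔ᵖ-upperˡ (proj₁ (M τ)) (proj₁ E) , ⊔ᵖ-upperˡ (proj₂ (M τ)) (proj₂ E)
    ... | false = ⊑ᵉ-refl

    []⊔-upper : ∀ M σ E → E ⊑ᵉ (M [ σ ]⊔ E) σ
    []⊔-upper M σ E rewrite dec-true (σ ≟ˢ σ) refl =
      ⊔ᵖ-upperʳ (proj₁ (M σ)) (proj₁ E) , ⊔ᵖ-upperʳ (proj₂ (M σ)) (proj₂ E)

    process-increases : ∀ σ {t t′} → process σ t ≡ just t′ → t ≼ t′
    process-increases σ@(sig C r m m∈ ss) {F , M} eq with if-does⁻ (C ∈Cls? r) eq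
    ... | inj₂ (_ , refl) = ≼-refl
    ... | inj₁ (_ , eq′) with >>=-just⁻ (typeff M _ (proj₂ (mtable C m m∈)) F) eq′
    ... | (E , F′) , eqₑ , refl = ≼-trans
      (typeff-increases (proj₂ (mtable C m m∈)) eqₑ , []⊔-increases M σ E)
      (checkClassTable-increases (F′ , M [ σ ]⊔ E))

    process-wellFormed : ∀ σ {t t′} → process σ t ≡ just t′ → WellFormed t → WellFormed t′
    process-wellFormed (sig C r m m∈ ss) {F , M} eq wf with if-does⁻ (C ∈Cls? r) eq
    ... | inj₂ (_ , refl) = wf
    ... | inj₁ (_ , eq′) with >>=-just⁻ (typeff M _ (proj₂ (mtable C m m∈)) F) eq′
    ... | (E , F′) , _ , refl = checkClassTable-wellFormed (F′ , _)

    TypedAt : Table → Sig → Set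
    TypedAt t (sig C r m m∈ ss) =
      let (xs , e) = mtable C m m∈
          (T , S)  = proj₂ t (sig C r m m∈ ss)
      in _⊢_∶_calls_ t (methodEnv r xs ss) e T S

    process-sound : ∀ σ {t t′ t″} → process σ t ≡ just t′ → t′ ≼ t″ → t″ ≼ t →
      cls σ ∈Cls reg σ → TypedAt t″ σ
    process-sound σ@(sig C r m m∈ ss) {F , M} eq t′≼t″ (F″⊆F , M″⊑M) C∈ with if-does⁻ (C ∈Cls? r) eq
    ... | inj₂ (C∉ , _)  = contradiction C∈ C∉
    ... | inj₁ (_ , eq′) with >>=-just⁻ (typeff M _ (proj₂ (mtable C m m∈)) F) eq′
    ... | (E , F′) , eqₑ , refl =
      let (F′⊆ , M⊑) = ≼-trans (checkClassTable-increases (F′ , M [ σ ]⊔ E)) t′≼t″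
          E⊑         = ⊑ᵉ-trans ([]⊔-upper M σ E) (M⊑ σ)
      in sub (typeff-sound (proj₂ (mtable C m m∈)) eqₑ F″⊆F F′⊆ M″⊑M) (type-⊑ E⊑) (calls-⊑ E⊑)

    round-increases : ∀ σs {t t′} → round σs t ≡ just t′ → t ≼ t′
    round-increases []       refl = ≼-refl
    round-increases (σ ∷ σs) {t} eq with >>=-just⁻ (process σ t) eq
    ... | _ , eq₁ , eq₂ = ≼-trans (process-increases σ eq₁) (round-increases σs eq₂)

    round-wellFormed : ∀ σs {t t′} → round σs t ≡ just t′ → WellFormed t → WellFormed t′
    round-wellFormed []       refl wf = wf
    round-wellFormed (σ ∷ σs) {t} eq wf with >>=-just⁻ (process σ t) eq
    ... | _ , eq₁ , eq₂ = round-wellFormed σs eq₂ (process-wellFormed σ eq₁ wf)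

    round-sound : ∀ σs {t t′ t″} → round σs t ≡ just t′ → t′ ≼ t″ → t″ ≼ t →
      ∀ {σ} → σ ∈ᴸ σs → cls σ ∈Cls reg σ → TypedAt t″ σ
    round-sound (σ ∷ σs) {t} eq t′≼t″ t″≼t σ∈ with >>=-just⁻ (process σ t) eq
    round-sound (σ ∷ σs) eq t′≼t″ t″≼t (here refl) | _ , eq₁ , eq₂ =
      process-sound σ eq₁ (≼-trans (round-increases σs eq₂) t′≼t″) t″≼t
    round-sound (σ ∷ σs) eq t′≼t″ t″≼t (there σ∈)  | _ , eq₁ , eq₂ =
      round-sound σs eq₂ t′≼t″ (≼-trans t″≼t (process-increases σ eq₁)) σ∈

    initial-wellFormed : WellFormed initial
    initial-wellFormed = record
      { F-Null    = λ C r f f∈ → _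
      ; F-Unknown = λ C r f f∈ s → id
      ; F-inv     = λ C⪯D r f p q → (λ s → id) , (λ s → id)
      ; M-mono    = λ C⪯D r m p q ss → ⊑ᵉ-refl
      }

    Repeat-wellFormed : ∀ {σs t t′} → Repeat σs t t′ → WellFormed t → WellFormed t′
    Repeat-wellFormed {σs} (stop eq _)         wf = round-wellFormed σs eq wf
    Repeat-wellFormed {σs} (again eq _ repeat) wf = Repeat-wellFormed repeat (round-wellFormed σs eq wf)

    Repeat-wellTyped : ∀ {σs} → IsEnumeration (setoid Sig) σs → ∀ {t t′} → Repeat σs t t′ → WellTyped t′
    Repeat-wellTyped {σs} enum (stop eq (t′≼t , _)) C r m m∈ ss C∈ =
      round-sound σs eq ≼-refl t′≼t (enum (sig C r m m∈ ss)) C∈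
    Repeat-wellTyped enum (again _ _ repeat) = Repeat-wellTyped enum repeat

    -- A table amounts to the finite set of facts that it asserts.
    data Fact : Set where
      field-fact  : Cls × Fld × Reg × Reg → Fact
      method-fact : Sig × (Reg ⊎ Sig) × M*.Carrier → Fact

    component : Effect → Reg ⊎ Sig → M*.Carrier
    component (T , S) = [ ⟦_⟧ ∘ T , ⟦_⟧ ∘ S ]′

    Asserts : Table → Fact → Set
    Asserts (F , M) (field-fact (C , f , r , s)) = Σ (f ∈ fields C) λ f∈ → s ∈ᴿ F C r f f∈
    Asserts (F , M) (method-fact (σ , k , a))    = a M*.≤ component (M σ) k

    asserts? : ∀ t φ → Dec (Asserts t φ)
    asserts? (F , M) (field-fact (C , f , r , s)) = Σ-dec-irr (f ∈? fields C) λ f∈ → T? (F C r f f∈ s)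
    asserts? (F , M) (method-fact (σ , k , a))    =
      ≈-dec⇒≤-dec M* (Finite._≟_ M*-finite) a (component (M σ) k)

    asserts-mono : ∀ {t t′} → t ≼ t′ → ∀ φ → Asserts t φ → Asserts t′ φ
    asserts-mono (F⊆ , _) (field-fact (C , f , r , s))    (f∈ , s∈) = f∈ , F⊆ C r f f∈ s s∈
    asserts-mono (_ , M⊑) (method-fact (σ , inj₁ r , a)) a≤        = M*.trans a≤ (type-⊑ (M⊑ σ) r)
    asserts-mono (_ , M⊑) (method-fact (σ , inj₂ τ , a)) a≤        = M*.trans a≤ (calls-⊑ (M⊑ σ) τ)

    module _ (σs : List Sig) (enum : IsEnumeration (setoid Sig) σs) where

      facts : List Fact
      facts =
        map field-fact (cartesianProduct (allFin #Cls)
          (cartesianProduct (allFin #Fld) (cartesianProduct regions regions))) ++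
        map method-fact (cartesianProduct σs
          (cartesianProduct (map inj₁ regions ++ map inj₂ σs) (Finite.elements M*-finite)))

      asserts-reflects : ∀ {t t′} → (∀ {φ} → φ ∈ᴸ facts → Asserts t φ → Asserts t′ φ) → t ≼ t′
      asserts-reflects {F , M} {F′ , M′} implies =
        (λ C r f f∈ s s∈ → proj₂ (implies
          (∈-++⁺ˡ (∈-map⁺ field-fact (∈-cartesianProduct⁺ (∈-allFin C) (∈-cartesianProduct⁺ (∈-allFin f)
            (∈-cartesianProduct⁺ (∈-regions r) (∈-regions s))))))
          (recompute (f ∈? fields C) f∈ , s∈))) ,
        (λ σ → (λ r → component-≤ σ (inj₁ r) (∈-++⁺ˡ (∈-map⁺ inj₁ (∈-regions r)))) ,
               (λ τ → component-≤ σ (inj₂ τ) (∈-++⁺ʳ (map inj₁ regions) (∈-map⁺ inj₂ (enum τ)))))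
        where
        component-≤ : ∀ σ k → k ∈ᴸ map inj₁ regions ++ map inj₂ σs →
          component (M σ) k M*.≤ component (M′ σ) k
        component-≤ σ k k∈ with find (Finite.complete M*-finite (component (M σ) k))
        ... | a , a∈ , v≈a = M*.trans (M*.reflexive v≈a) (implies
          (∈-++⁺ʳ _ (∈-map⁺ method-fact (∈-cartesianProduct⁺ (enum σ) (∈-cartesianProduct⁺ k∈ a∈))))
          (M*.reflexive (M*.Eq.sym v≈a)))

      #unasserted : Table → ℕ
      #unasserted t = length (filter (¬? ∘ asserts? t) facts)

      #unasserted-antitone : ∀ {t t′} → t ≼ t′ → #unasserted t′ ≤ #unasserted t
      #unasserted-antitone {t} {t′} t≼t′ =
        length-filter-≤ (¬? ∘ asserts? t′) (¬? ∘ asserts? t) (λ {φ} ¬a → ¬a ∘ asserts-mono t≼t′ φ) facts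

      #unasserted-≡⇒≼ : ∀ {t t′} → t ≼ t′ → #unasserted t′ ≡ #unasserted t → t′ ≼ t
      #unasserted-≡⇒≼ {t} {t′} t≼t′ eq = asserts-reflects λ {φ} φ∈ a →
        decidable-stable (asserts? t φ) λ ¬a →
          length-filter-≡ (¬? ∘ asserts? t′) (¬? ∘ asserts? t)
            (λ {φ} ¬a → ¬a ∘ asserts-mono t≼t′ φ) eq φ∈ ¬a a

      Repeat-total : (∀ t → Defined (round σs t)) → ∀ t → Acc _<_ (#unasserted t) → ∃ (Repeat σs t)
      Repeat-total round-def t (acc rec) with round-def t
      ... | t′ , eq with #unasserted t′ ≟ᴺ #unasserted t
      ... | yes same =
        let t≼t′ = round-increases σs eq in t′ , stop eq (#unasserted-≡⇒≼ t≼t′ same , t≼t′)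
      ... | no  differ =
        let decreases    = ≤∧≢⇒< (#unasserted-antitone (round-increases σs eq)) differ
            changed      = λ (t′≼t , t≼t′) →
              differ (≤-antisym (#unasserted-antitone t≼t′) (#unasserted-antitone t′≼t))
            t″ , repeat  = Repeat-total round-def t′ (rec decreases)
        in t″ , again eq changed repeat

theorem5p11 :
    {Letter : Set} → Finite (setoid Letter) →
    (𝔅 : BüchiAbstraction Letter) (𝔄 : Words.Language≤ω Letter) → Faithful 𝔅 𝔄 →
    (N : Names) (let open FJ Letter N) (P : Program) →
    (let open Standard P renaming (WellTyped to StandardWellTyped)) →
    (𝒯₀ : ClassTable) → StandardWellTyped 𝒯₀ →
    (let open Inference 𝔅 P) →
    (σs : List Sig) → IsEnumeration (setoid Sig) σs →
    ∃ λ t → (𝒜[ σs ]⇓ t) × WellFormed t × WellTyped t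
theorem5p11 _ 𝔅 _ _ N P 𝒯₀ wellTyped₀ σs enum =
  let t , repeat = Repeat-total 𝔅 P σs enum (round-defined 𝔅 P wellTyped₀ σs) _ (<-wellFounded _)
  in t , repeat ,
     Repeat-wellFormed 𝔅 P repeat (initial-wellFormed 𝔅 P) ,
     Repeat-wellTyped 𝔅 P enum repeat
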